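{- The maps $\rho_i:\mathcal{A}_n\to\mathcal{A}_n$, $0\le i\le n-2$, when extended multiplicatively (i.e. letting the generator $s_i$ act by $\rho_i$), determine a well-defined $\widetilde C_{n-2}$-action on the set of arc permutations $\mathcal{A}_n$.
   Context: An interval in $\mathbb{Z}_n$ is a subset of $\{1,\dots,n\}$ of the form $[a,b]$ or $[b,n]\cup[1,a]$ with $1\le a\le b\le n$. $\mathcal{A}_n$ is the set of arc permutations: those $\pi$ in the symmetric group $\mathcal{S}_n$ such that for every $1\le j\le n$ the set $\{\pi(1),\dots,\pi(j)\}$ of the first $j$ letters of $\pi$ is an interval in $\mathbb{Z}_n$. Let $\sigma_i=(i,i+1)$ be the adjacent transposition, with $\pi\sigma_i$ obtained from $\pi$ by exchanging the letters in positions $i$ and $i+1$. For $0\le i\le n-2$, the map $\rho_i:\mathcal{A}_n\to\mathcal{A}_n$ is defined by $\rho_i(\pi)=\pi\sigma_{i+1}$ if $\pi\sigma_{i+1}\in\mathcal{A}_n$, and $\rho_i(\pi)=\pi$ otherwise. The affine Weyl group $\widetilde C_{n-2}$ is generated by $s_0,s_1,\dots,s_{n-2}$ subject to the Coxeter relations: $s_i^2=1$ for all $i$; $(s_is_j)^2=1$ for $|j-i|>1$; $(s_is_{i+1})^3=1$ for $1\le i<n-3$; $(s_is_{i+1})^4=1$ for $i=0,n-3$.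
   Formalization: The formal theorem assumes n ≥ 4; for n = 3 the claim fails, since the relation (s_0 s_1)^4 = 1 would be required while ρ_0ρ_1 has order 3 on A_3 = S_3, and for n ≤ 2 the listed relations involve nonexistent generators. -}

module Defs where

open import Algebra.Bundles using (Group)
open import Data.Fin.Base using (Fin; suc; toℕ; inject₁; _≤_)
open import Data.Fin.Permutation using (Permutation′; _⟨$⟩ʳ_; transpose; _∘ₚ_)
  renaming (_≈_ to _≈ₚ_)
open import Data.Fin.Properties using (_≟_; _≤?_; any?; all?)
open import Data.Nat.Base as ℕ using (ℕ; zero; ∣_-_∣)
open import Data.Product.Base using (_×_; _,_; ∃; ∃₂)
open import Data.Sum.Base using (_⊎_)
open import Level using (Level; _⊔_; 0ℓ)
open import Relation.Binary.Bundles using (Setoid)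
open import Relation.Binary.PropositionalEquality as ≡ using (_≡_)
open import Relation.Nullary.Decidable
  using (Dec; yes; no; map′; _×-dec_; _⊎-dec_; _→-dec_)
open import Relation.Unary using (Pred; Decidable; _≐_; _∩_; _∪_)

-- The letters and positions 1, …, n are represented by Fin n, so every
-- label is shifted down by one.

-- [a,b]
segment : ∀ {n} → Fin n → Fin n → Pred (Fin n) 0ℓ
segment a b = (a ≤_) ∩ (_≤ b)

-- [b,n] ∪ [1,a]
wrap : ∀ {n} → Fin n → Fin n → Pred (Fin n) 0ℓ
wrap a b = (b ≤_) ∪ (_≤ a)

IsInterval : ∀ {n} → Pred (Fin n) 0ℓ → Set
IsInterval P = ∃₂ λ a b → a ≤ b × (P ≐ segment a b ⊎ P ≐ wrap a b)

-- The set of the letters of π up to and including position j; since j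
-- ranges over Fin n, this covers the initial segments of lengths 1, …, n.
letters : ∀ {n} → Permutation′ n → Fin n → Pred (Fin n) 0ℓ
letters π j x = ∃ λ k → k ≤ j × π ⟨$⟩ʳ k ≡ x

IsArc : ∀ {n} → Permutation′ n → Set
IsArc π = ∀ j → IsInterval (letters π j)

record ArcPermutation (n : ℕ) : Set where
  constructor mkArc
  field
    perm  : Permutation′ n
    isArc : IsArc perm

open ArcPermutation public

-- Arc permutations are identified when they agree as functions; the proof
-- of being an arc permutation is irrelevant.
𝒜 : ℕ → Setoid 0ℓ 0ℓ
𝒜 n = record
  { Carrier       = ArcPermutation n
  ; _≈_           = λ π τ → perm π ≈ₚ perm τ
  ; isEquivalence = record
    { refl  = λ _ → ≡.refl
    ; sym   = λ p k → ≡.sym (p k)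
    ; trans = λ p q k → ≡.trans (p k) (q k)
    }
  }

≐? : ∀ {n} {P Q : Pred (Fin n) 0ℓ} → Decidable P → Decidable Q → Dec (P ≐ Q)
≐? P? Q? =
  map′ (λ f {x} → f x) (λ f x → f {x}) (all? λ x → P? x →-dec Q? x)
    ×-dec
  map′ (λ f {x} → f x) (λ f x → f {x}) (all? λ x → Q? x →-dec P? x)

isInterval? : ∀ {n} {P : Pred (Fin n) 0ℓ} → Decidable P → Dec (IsInterval P)
isInterval? P? = any? λ a → any? λ b → (a ≤? b) ×-dec
  (≐? P? (λ x → (a ≤? x) ×-dec (x ≤? b)) ⊎-dec
   ≐? P? (λ x → (b ≤? x) ⊎-dec (x ≤? a)))

isArc? : ∀ {n} (π : Permutation′ n) → Dec (IsArc π)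
isArc? π = all? λ j → isInterval? λ x →
  any? λ k → (k ≤? j) ×-dec ((π ⟨$⟩ʳ k) ≟ x)

-- π ·σ i exchanges the letters in the 0-based positions i and i + 1, i.e.
-- it is πσᵢ₊₁ in 1-based notation.  Note that _∘ₚ_ applies its left
-- argument first.
_·σ_ : ∀ {m} → Permutation′ (ℕ.suc m) → Fin m → Permutation′ (ℕ.suc m)
π ·σ i = transpose (inject₁ i) (suc i) ∘ₚ π

ρ : ∀ {m} → Fin m → ArcPermutation (ℕ.suc m) → ArcPermutation (ℕ.suc m)
ρ i π with isArc? (perm π ·σ i)
... | yes arc = mkArc (perm π ·σ i) arc
... | no _    = π

infixl 7 _∙_
infix  8 _⁻¹
infixr 8 _^_

data Word (S : Set) : Set where
  gen : S → Word S
  ε   : Word S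
  _∙_ : Word S → Word S → Word S
  _⁻¹ : Word S → Word S

_^_ : ∀ {S} → Word S → ℕ → Word S
w ^ zero      = ε
w ^ (ℕ.suc k) = w ∙ w ^ k

-- The least congruence on words that satisfies the group laws and
-- makes every word in R trivial.
data Equal {S : Set} (R : Pred (Word S) 0ℓ) : Word S → Word S → Set where
  relator   : ∀ {w} → R w → Equal R w ε
  reflᵉ     : ∀ {w} → Equal R w w
  symᵉ      : ∀ {v w} → Equal R v w → Equal R w v
  transᵉ    : ∀ {u v w} → Equal R u v → Equal R v w → Equal R u w
  ∙-cong    : ∀ {u v w z} → Equal R u v → Equal R w z → Equal R (u ∙ w) (v ∙ z)
  ⁻¹-cong   : ∀ {v w} → Equal R v w → Equal R (v ⁻¹) (w ⁻¹)
  assoc     : ∀ u v w → Equal R ((u ∙ v) ∙ w) (u ∙ (v ∙ w))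
  identityˡ : ∀ w → Equal R (ε ∙ w) w
  identityʳ : ∀ w → Equal R (w ∙ ε) w
  inverseˡ  : ∀ w → Equal R (w ⁻¹ ∙ w) ε
  inverseʳ  : ∀ w → Equal R (w ∙ w ⁻¹) ε

⟨_∣_⟩ : (S : Set) → Pred (Word S) 0ℓ → Group 0ℓ 0ℓ
⟨ S ∣ R ⟩ = record
  { Carrier = Word S
  ; _≈_     = Equal R
  ; _∙_     = _∙_
  ; ε       = ε
  ; _⁻¹     = _⁻¹
  ; isGroup = record
    { isMonoid = record
      { isSemigroup = record
        { isMagma = record
          { isEquivalence = record { refl = reflᵉ ; sym = symᵉ ; trans = transᵉ }
          ; ∙-cong        = ∙-cong
          }
        ; assoc = assoc
        }
      ; identity = identityˡ , identityʳ
      }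
    ; inverse = inverseˡ , inverseʳ
    ; ⁻¹-cong = ⁻¹-cong
    }
  }

s : ∀ {m} → Fin (ℕ.suc m) → Word (Fin (ℕ.suc m))
s = gen

-- The defining relations of type C̃ₘ on generators s₀, …, sₘ.  For
-- i : Fin m, the consecutive generators sᵢ and sᵢ₊₁ are s (inject₁ i) and
-- s (suc i).  This is the affine Weyl group of type C̃ₘ only for m ≥ 2;
-- for m = 1 both ends of the diagram coincide and the relations would
-- force (s₀s₁)⁴ = 1.
data C̃-Relator (m : ℕ) : Pred (Word (Fin (ℕ.suc m))) 0ℓ where
  involution : ∀ i → C̃-Relator m (s i ^ 2)
  commute    : ∀ i j → ∣ toℕ j - toℕ i ∣ ℕ.> 1 → C̃-Relator m ((s i ∙ s j) ^ 2)
  braid₃     : ∀ i → 1 ℕ.≤ toℕ i → ℕ.suc (toℕ i) ℕ.< m →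
               C̃-Relator m ((s (inject₁ i) ∙ s (suc i)) ^ 3)
  braid₄     : ∀ i → toℕ i ≡ 0 ⊎ ℕ.suc (toℕ i) ≡ m →
               C̃-Relator m ((s (inject₁ i) ∙ s (suc i)) ^ 4)

C̃ : ℕ → Group 0ℓ 0ℓ
C̃ m = ⟨ Fin (ℕ.suc m) ∣ C̃-Relator m ⟩

record Action {g ℓ₁ x ℓ₂ : Level} (G : Group g ℓ₁) (X : Setoid x ℓ₂)
  : Set (g ⊔ ℓ₁ ⊔ x ⊔ ℓ₂) where
  private
    module G = Group G
    module X = Setoid X
  infixr 6 _▷_
  field
    _▷_        : G.Carrier → X.Carrier → X.Carrier
    ▷-cong     : ∀ {g h x y} → g G.≈ h → x X.≈ y → (g ▷ x) X.≈ (h ▷ y)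
    ▷-identity : ∀ x → (G.ε ▷ x) X.≈ x
    ▷-compose  : ∀ g h x → ((g G.∙ h) ▷ x) X.≈ (g ▷ (h ▷ x))

module _ {g ℓ₁ x ℓ₂ : Level} {G : Group g ℓ₁} {X : Setoid x ℓ₂} where

  open Action using (_▷_)

  _≗ᵃ_ : Action G X → Action G X → Set (g ⊔ x ⊔ ℓ₂)
  α ≗ᵃ β = ∀ g x → Setoid._≈_ X (_▷_ α g x) (_▷_ β g x)

Extends : ∀ {m} {x ℓ : Level} {X : Setoid x ℓ} →
          (Fin (ℕ.suc m) → Setoid.Carrier X → Setoid.Carrier X) →
          Action (C̃ m) X → Set (x ⊔ ℓ)
Extends {X = X} f α = ∀ i x → Setoid._≈_ X (Action._▷_ α (s i) x) (f i x)

module Submission where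

open import Defs
open import Data.Nat.Base using (ℕ; _+_; _≤_)
open import Data.Product using (∃!)

open import Data.Bool.Base using (Bool; true; if_then_else_)
open import Data.Fin.Base as Fin using (Fin; zero; suc; toℕ; fromℕ; fromℕ<; inject₁)
open import Data.Fin.Induction using (<-weakInduction; <-weakInduction-startingFrom)
open import Data.Fin.Patterns using (0F; 1F; 2F)
open import Data.Fin.Permutation using (Permutation′; _⟨$⟩ʳ_; _⟨$⟩ˡ_)
  renaming (_≈_ to _≈ₚ_; inverseˡ to from-to; inverseʳ to to-from)
open import Data.Fin.Properties
  using (_≟_; _≤?_; any?; ≤-refl; ≤-antisym; ≤fromℕ; suc-injective; inject₁-injective;
         toℕ-inject₁; toℕ-injective; toℕ<n; toℕ-fromℕ; toℕ-fromℕ<)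
open import Data.Fin.Relation.Unary.Top
  using (view; ‵fromℕ; ‵inject₁; view-fromℕ; view-inject₁)
open import Data.Nat.Base as ℕ using (∣_-_∣)
import Data.Nat.Properties as ℕ
open import Data.Product.Base using (_×_; _,_; ∃; proj₁; proj₂)
open import Data.Sum.Base as Sum using (_⊎_; inj₁; inj₂; [_,_]′)
open import Function.Base using (_∘_; id)
open import Level using (Level; 0ℓ)
open import Relation.Binary.Bundles using (Setoid)
open import Relation.Binary.Definitions using (tri<; tri≈; tri>)
open import Relation.Binary.PropositionalEquality
  using (_≡_; _≢_; refl; sym; trans; cong; subst; subst₂; ≢-sym)
open import Relation.Nullary using (¬_; Dec; yes; no; contradiction)
open import Relation.Nullary.Decidable
  using (map′; _×-dec_; _⊎-dec_; decidable-stable; dec-true; dec-false)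
open import Relation.Nullary.Reflects using (Reflects; ofʸ; ofⁿ)
open import Relation.Unary
  using (Pred; Decidable; Satisfiable; _∈_; _∉_; _⊆_; _≐_; _∪_; ∁; ｛_｝)
open import Relation.Unary.Properties using (∁?; _∪?_; ≐-sym; ≐-trans)

-- Let P and R be the sets of letters before and after three consecutive
-- positions of an arc permutation.  Exchanging the first two of the letters
-- x, y, z in these positions gives an arc permutation iff P ∪ {y} is an
-- interval, and exchanging the last two does iff R ∪ {y} is one.  An interval
-- can be extended at its two ends only, so if P and R are nonempty then the
-- arc permutations among the six orderings of the three letters form a path
-- with one or three vertices, on which the product of the two maps has order
-- dividing 3.  If P or R is empty then they form a path with four vertices
-- and the product has order 4.

-- Two involutions that alternate along the edges of a path with `k` vertices, each fixing an end
-- where it has no edge, have as product a single `k`-cycle; hence the exponents 3 and 4. No path is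
-- ever built. Exchanges inside the triple leave `P` and `R` alone, so the moves are governed by six
-- yes-or-no facts: whether `P` or `R` stays an interval when a given one of the three letters joins
-- it. Two of them hold because the given permutation is an arc permutation. Counting the ends of
-- intervals refutes the inconsistent values of the others, and evaluation settles each surviving
-- pattern. As intervals come in two shapes, which complementation may exchange, their ends are
-- located by the steps around the cycle that leave or enter the set.

private
  variable
    k n m : ℕ
    ℓ₁ ℓ₂ : Level
    P Q R : Pred (Fin (ℕ.suc k)) 0ℓ
    a b c e f x y z : Fin (ℕ.suc k)

-- The cyclic successor

next : Fin (ℕ.suc k) → Fin (ℕ.suc k)
next x with view x
... | ‵fromℕ     = zero
... | ‵inject₁ i = suc i

next-fromℕ : next (fromℕ k) ≡ zero
next-fromℕ {k} rewrite view-fromℕ k = refl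

next-inject₁ : (i : Fin k) → next (inject₁ i) ≡ suc i
next-inject₁ i rewrite view-inject₁ i = refl

next-cases : (x : Fin (ℕ.suc k)) →
             toℕ (next x) ≡ ℕ.suc (toℕ x) ⊎ next x ≡ zero × (∀ (y : Fin (ℕ.suc k)) → y Fin.≤ x)
next-cases x with view x
... | ‵fromℕ     = inj₂ (refl , ≤fromℕ)
... | ‵inject₁ i = inj₁ (cong ℕ.suc (sym (toℕ-inject₁ i)))

next-injective : {x y : Fin (ℕ.suc k)} → next x ≡ next y → x ≡ y
next-injective {x = x} {y} eq with view x | view y
... | ‵fromℕ     | ‵fromℕ     = refl
... | ‵inject₁ i | ‵inject₁ j = cong inject₁ (suc-injective eq)

-- Climbing from `x` reaches the top element, whose successor is `zero`; climbing from there reaches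
-- everything.
next-induction : {P : Pred (Fin (ℕ.suc k)) 0ℓ} → (∀ x → x ∈ P → next x ∈ P) →
                 ∀ {x} → x ∈ P → ∀ y → y ∈ P
next-induction {k} {P} closed {x} x∈P =
  <-weakInduction P (subst P next-fromℕ (closed _ last∈P)) up
  where
  up : ∀ i → inject₁ i ∈ P → suc i ∈ P
  up i = subst P (next-inject₁ i) ∘ closed (inject₁ i)

  last∈P : fromℕ k ∈ P
  last∈P = <-weakInduction-startingFrom P x∈P up (≤fromℕ x)

-- Sets with at most one exit and one entry

Exit Entry : Pred (Fin (ℕ.suc k)) 0ℓ → Pred (Fin (ℕ.suc k)) 0ℓ
Exit  P x = x ∈ P × next x ∉ P
Entry P x = x ∉ P × next x ∈ P

-- For a nonempty P this says that P is an interval of the cycle; unlike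
-- IsInterval it also holds for the empty set, and it is invariant under
-- complementation.
record Cyclic (P : Pred (Fin (ℕ.suc k)) 0ℓ) : Set where
  field
    exit!  : ∀ {x y} → x ∈ Exit P → y ∈ Exit P → x ≡ y
    entry! : ∀ {x y} → x ∈ Entry P → y ∈ Entry P → x ≡ y

open Cyclic

Cyclic-resp-≐ : P ≐ Q → Cyclic P → Cyclic Q
Cyclic-resp-≐ (P⊆Q , Q⊆P) C = record
  { exit!  = λ (x∈ , x∉) (y∈ , y∉) → exit! C (Q⊆P x∈ , x∉ ∘ P⊆Q) (Q⊆P y∈ , y∉ ∘ P⊆Q)
  ; entry! = λ (x∉ , x∈) (y∉ , y∈) → entry! C (x∉ ∘ P⊆Q , Q⊆P x∈) (y∉ ∘ P⊆Q , Q⊆P y∈)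
  }

Cyclic-∁ : Decidable P → Cyclic P → Cyclic (∁ P)
Cyclic-∁ {P = P} P? C = record
  { exit!  = λ (x∉ , x∈) (y∉ , y∈) → entry! C (x∉ , stable x∈) (y∉ , stable y∈)
  ; entry! = λ (x∈ , x∉) (y∈ , y∉) → exit! C (stable x∈ , x∉) (stable y∈ , y∉)
  }
  where
  stable : ∀ {x} → ¬ x ∉ P → x ∈ P
  stable {x} = decidable-stable (P? x)

Cyclic-empty : (∀ x → x ∉ P) → Cyclic P
Cyclic-empty empty = record
  { exit!  = λ (x∈ , _) _ → contradiction x∈ (empty _)
  ; entry! = λ (_ , x∈) _ → contradiction x∈ (empty _)
  }

Cyclic-full : (∀ x → x ∈ P) → Cyclic P
Cyclic-full full = record
  { exit!  = λ (_ , x∉) _ → contradiction (full _) x∉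
  ; entry! = λ (x∉ , _) _ → contradiction (full _) x∉
  }

-- Needed at either end of a permutation: next to an empty set every letter can be added, not just
-- two, which lengthens the path from three vertices to four.
Cyclic-singleton : (∀ x → x ∉ P) → Cyclic (P ∪ ｛ a ｝)
Cyclic-singleton {P = P} {a = a} empty = record
  { exit!  = λ (x∈ , _) (y∈ , _) → trans (sym (is-a x∈)) (is-a y∈)
  ; entry! = λ (_ , x∈) (_ , y∈) → next-injective (trans (sym (is-a x∈)) (is-a y∈))
  }
  where
  is-a : ∀ {x} → x ∈ P ∪ ｛ a ｝ → a ≡ x
  is-a = [ (λ x∈ → contradiction x∈ (empty _)) , id ]′

-- A set that no step leaves is closed under `next`, so it contains everything as soon as it
-- contains `a`.
∃-exit : Decidable P → a ∈ P → b ∉ P → Satisfiable (Exit P)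
∃-exit {P = P} P? a∈ b∉ with any? (λ x → P? x ×-dec ∁? P? (next x))
... | yes exit = exit
... | no  none = contradiction (next-induction closed a∈ _) b∉
  where
  closed : ∀ x → x ∈ P → next x ∈ P
  closed x x∈ = decidable-stable (P? (next x)) (λ nx∉ → none (x , x∈ , nx∉))

∃-entry : Decidable P → a ∈ P → b ∉ P → Satisfiable (Entry P)
∃-entry P? a∈ b∉ with ∃-exit (∁? P?) b∉ (λ a∉ → a∉ a∈)
... | x , x∉ , nx∈ = x , x∉ , decidable-stable (P? (next x)) nx∈

-- The symmetric difference of P and Q is closed under next and misses e.
exit-entry-determine : Decidable P → Decidable Q → Cyclic P → Cyclic Q →
                       e ∈ Exit P → e ∈ Exit Q → f ∈ Entry P → f ∈ Entry Q → P ⊆ Q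
exit-entry-determine {P = P} {Q = Q} {e = e} P? Q? CP CQ eP eQ fP fQ {x} x∈P =
  decidable-stable (Q? x) λ x∉Q →
    [ (λ (_ , e∉Q) → e∉Q (proj₁ eQ)) , (λ (_ , e∉P) → e∉P (proj₁ eP)) ]′
      (next-induction {P = Δ} closed (inj₁ (x∈P , x∉Q)) e)
  where
  Δ : Pred _ 0ℓ
  Δ y = (y ∈ P × y ∉ Q) ⊎ (y ∈ Q × y ∉ P)

  step : ∀ {P Q} → Decidable P → Cyclic P → Cyclic Q → e ∈ Exit P → e ∈ Exit Q →
         ∀ {f} → f ∈ Entry P → f ∈ Entry Q →
         ∀ y → y ∈ P × y ∉ Q → next y ∈ P × next y ∉ Q
  step P? CP CQ eP eQ fP fQ y (y∈P , y∉Q) =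
    decidable-stable (P? (next y))
      (λ ny∉P → y∉Q (subst _ (exit! CP eP (y∈P , ny∉P)) (proj₁ eQ))) ,
    (λ ny∈Q → proj₁ fP (subst _ (entry! CQ (y∉Q , ny∈Q) fQ) y∈P))

  closed : ∀ y → y ∈ Δ → next y ∈ Δ
  closed y (inj₁ d) = inj₁ (step P? CP CQ eP eQ fP fQ y d)
  closed y (inj₂ d) = inj₂ (step Q? CQ CP eQ eP fQ fP y d)

-- Intervals as the nonempty cyclic sets

Cyclic-segment : (a b : Fin (ℕ.suc k)) → a Fin.≤ b → Cyclic (segment a b)
Cyclic-segment a b a≤b = record
  { exit!  = λ x y → trans (exit x) (sym (exit y))
  ; entry! = λ x y → next-injective (trans (entry x) (sym (entry y)))
  }
  where
  exit : ∀ {x} → x ∈ Exit (segment a b) → x ≡ b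
  exit {x} ((a≤x , x≤b) , nx∉) with next-cases x
  ... | inj₂ (_ , max) = ≤-antisym x≤b (max b)
  ... | inj₁ eq        = ≤-antisym x≤b (ℕ.≮⇒≥ λ x<b → nx∉
    ( ℕ.≤-trans a≤x (ℕ.≤-trans (ℕ.n≤1+n _) (ℕ.≤-reflexive (sym eq)))
    , ℕ.≤-trans (ℕ.≤-reflexive eq) x<b))

  entry : ∀ {x} → x ∈ Entry (segment a b) → next x ≡ a
  entry {x} (x∉ , a≤nx , nx≤b) with next-cases x
  ... | inj₂ (eq , _) = ≤-antisym (subst (Fin._≤ a) (sym eq) ℕ.z≤n) a≤nx
  ... | inj₁ eq       = ≤-antisym (ℕ.≤-trans (ℕ.≤-reflexive eq) (ℕ.≰⇒> λ a≤x → x∉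
    (a≤x , ℕ.≤-trans (ℕ.n≤1+n _) (ℕ.≤-trans (ℕ.≤-reflexive (sym eq)) nx≤b)))) a≤nx

Cyclic-wrap : (a b : Fin (ℕ.suc k)) → a Fin.≤ b → Cyclic (wrap a b)
Cyclic-wrap a b a≤b = record
  { exit!  = λ x y → trans (exit x) (sym (exit y))
  ; entry! = λ x y → next-injective (trans (entry x) (sym (entry y)))
  }
  where
  exit : ∀ {x} → x ∈ Exit (wrap a b) → x ≡ a
  exit {x} (x∈ , nx∉) with next-cases x
  ... | inj₂ (eq , _) = contradiction (inj₂ (subst (Fin._≤ a) (sym eq) ℕ.z≤n)) nx∉
  ... | inj₁ eq       with x∈
  ...   | inj₁ b≤x = contradiction
    (inj₁ (ℕ.≤-trans b≤x (ℕ.≤-trans (ℕ.n≤1+n _) (ℕ.≤-reflexive (sym eq))))) nx∉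
  ...   | inj₂ x≤a = ≤-antisym x≤a
    (ℕ.≮⇒≥ λ x<a → nx∉ (inj₂ (ℕ.≤-trans (ℕ.≤-reflexive eq) x<a)))

  entry : ∀ {x} → x ∈ Entry (wrap a b) → next x ≡ b
  entry {x} (x∉ , nx∈) with next-cases x
  ... | inj₂ (_ , max) = contradiction (inj₁ (max b)) x∉
  ... | inj₁ eq        with nx∈
  ...   | inj₁ b≤nx = ≤-antisym
    (ℕ.≤-trans (ℕ.≤-reflexive eq) (ℕ.≰⇒> (x∉ ∘ inj₁))) b≤nx
  ...   | inj₂ nx≤a = contradiction
    (inj₂ (ℕ.≤-trans (ℕ.n≤1+n _) (ℕ.≤-trans (ℕ.≤-reflexive (sym eq)) nx≤a))) x∉

IsInterval⇒Cyclic : IsInterval P → Cyclic P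
IsInterval⇒Cyclic (a , b , a≤b , inj₁ eq) = Cyclic-resp-≐ (≐-sym eq) (Cyclic-segment a b a≤b)
IsInterval⇒Cyclic (a , b , a≤b , inj₂ eq) = Cyclic-resp-≐ (≐-sym eq) (Cyclic-wrap a b a≤b)

-- A nonempty proper subset has an entry `f` and an exit `e`. The candidate runs from `next f` round
-- to `e` and is a `segment` or a `wrap` according to the order of these two. It shares its exit and
-- entry with `P`, hence equals `P`.
Cyclic⇒IsInterval : Decidable P → Satisfiable P → Cyclic P → IsInterval P
Cyclic⇒IsInterval {P = P} P? (a , a∈P) C with any? (∁? P?)
... | no  full     = zero , fromℕ _ , ℕ.z≤n ,
  inj₁ ((λ _ → ℕ.z≤n , ≤fromℕ _) , λ {x} _ → decidable-stable (P? x) λ x∉ → full (x , x∉))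
... | yes (b , b∉P) with ∃-exit P? a∈P b∉P | ∃-entry P? a∈P b∉P
...   | e , e∈P , ne∉P | f , f∉P , nf∈P with next f ≤? e
...     | yes l≤e = next f , e , l≤e ,
  inj₁ ( exit-entry-determine P? S? C CS (e∈P , ne∉P) eS (f∉P , nf∈P) fS
       , exit-entry-determine S? P? CS C eS (e∈P , ne∉P) fS (f∉P , nf∈P))
  where
  S : Pred _ 0ℓ
  S = segment (next f) e

  S? : Decidable S
  S? x = next f ≤? x ×-dec x ≤? e

  CS : Cyclic S
  CS = Cyclic-segment (next f) e l≤e

  eS : e ∈ Exit S
  eS = (l≤e , ≤-refl) , λ (l≤ne , ne≤e) → [
      (λ eq → ℕ.1+n≰n (ℕ.≤-trans (ℕ.≤-reflexive (sym eq)) ne≤e)) ,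
      -- Here `next e` is `zero`, which can be at least `next f` only by being equal to it.
      (λ (eq , _) → ne∉P (subst P (≤-antisym l≤ne (subst (Fin._≤ next f) (sym eq) ℕ.z≤n)) nf∈P))
    ]′ (next-cases e)

  fS : f ∈ Entry S
  fS = (λ (l≤f , f≤e) → [
      (λ eq → ℕ.1+n≰n (ℕ.≤-trans (ℕ.≤-reflexive (sym eq)) l≤f)) ,
      (λ (_ , max) → f∉P (subst P (≤-antisym (max e) f≤e) e∈P))
    ]′ (next-cases f)) , ≤-refl , l≤e
...     | no  l≰e = e , next f , e≤l ,
  inj₂ ( exit-entry-determine P? W? C CW (e∈P , ne∉P) eW (f∉P , nf∈P) fW
       , exit-entry-determine W? P? CW C eW (e∈P , ne∉P) fW (f∉P , nf∈P))
  where
  e<l : e Fin.< next f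
  e<l = ℕ.≰⇒> l≰e

  e≤l : e Fin.≤ next f
  e≤l = ℕ.<⇒≤ e<l

  W : Pred _ 0ℓ
  W = wrap e (next f)

  W? : Decidable W
  W? x = next f ≤? x ⊎-dec x ≤? e

  CW : Cyclic W
  CW = Cyclic-wrap e (next f) e≤l

  eW : e ∈ Exit W
  eW = inj₂ ≤-refl , λ ne∈ → [
      (λ eq → [
          (λ l≤ne → ne∉P (subst P (≤-antisym l≤ne
                      (ℕ.≤-trans (ℕ.≤-reflexive eq) e<l)) nf∈P)) ,
          (λ ne≤e → ℕ.1+n≰n (ℕ.≤-trans (ℕ.≤-reflexive (sym eq)) ne≤e))
        ]′ ne∈) ,
      (λ (_ , max) → l≰e (max (next f)))
    ]′ (next-cases e)

  fW : f ∈ Entry W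
  fW = (λ f∈ → [
      (λ eq → [
          (λ l≤f → ℕ.1+n≰n (ℕ.≤-trans (ℕ.≤-reflexive (sym eq)) l≤f)) ,
          (λ f≤e → f∉P (subst P (≤-antisym
                      (ℕ.≤-pred (ℕ.≤-trans e<l (ℕ.≤-reflexive eq))) f≤e) e∈P))
        ]′ f∈) ,
      (λ (eq , _) → l≰e (subst (Fin._≤ e) (sym eq) ℕ.z≤n))
    ]′ (next-cases f)) , inj₁ ≤-refl

cyclic? : Decidable P → Satisfiable P → Dec (Cyclic P)
cyclic? P? ∃P = map′ IsInterval⇒Cyclic (Cyclic⇒IsInterval P? ∃P) (isInterval? P?)

-- Adding one letter to an interval

add-after-exit : Cyclic P → e ∈ Exit P → Cyclic (P ∪ ｛ next e ｝)
add-after-exit {P = P} {e = e} C (e∈P , ne∉P) = record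
  { exit!  = λ x y → trans (sym (exit x)) (exit y)
  ; entry! = λ x y → entry! C (entry x) (entry y)
  }
  where
  exit : ∀ {x} → x ∈ Exit (P ∪ ｛ next e ｝) → next e ≡ x
  exit (inj₂ eq  , _)   = eq
  exit (inj₁ x∈P , nx∉) = contradiction
    (inj₂ (cong next (exit! C (e∈P , ne∉P) (x∈P , nx∉ ∘ inj₁)))) nx∉

  entry : ∀ {x} → x ∈ Entry (P ∪ ｛ next e ｝) → x ∈ Entry P
  entry (x∉ , inj₁ nx∈P) = x∉ ∘ inj₁ , nx∈P
  entry (x∉ , inj₂ eq)   = contradiction (inj₁ (subst P (next-injective eq) e∈P)) x∉

add-at-entry : Cyclic P → f ∈ Entry P → Cyclic (P ∪ ｛ f ｝)
add-at-entry {P = P} {f = f} C (f∉P , nf∈P) = record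
  { exit!  = λ x y → exit! C (exit x) (exit y)
  ; entry! = λ x y → next-injective (trans (sym (entry x)) (entry y))
  }
  where
  exit : ∀ {x} → x ∈ Exit (P ∪ ｛ f ｝) → x ∈ Exit P
  exit (inj₁ x∈P  , nx∉) = x∈P , nx∉ ∘ inj₁
  exit (inj₂ refl , nx∉) = contradiction (inj₁ nf∈P) nx∉

  entry : ∀ {x} → x ∈ Entry (P ∪ ｛ f ｝) → f ≡ next x
  entry (x∉ , inj₂ eq)   = eq
  entry (x∉ , inj₁ nx∈P) =
    contradiction (inj₂ (entry! C (f∉P , nf∈P) (x∉ ∘ inj₁ , nx∈P))) x∉

-- If `next a` is in `P`, then `a` is the entry. Otherwise `a` becomes an exit of the enlarged set,
-- and so does `e` unless `a` is `next e`; two exits would coincide, although `e` lies in `P` and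
-- `a` does not.
addable-cases : Decidable P → Cyclic P → e ∈ Exit P → f ∈ Entry P →
                a ∉ P → Cyclic (P ∪ ｛ a ｝) → a ≡ next e ⊎ a ≡ f
addable-cases {P = P} {e = e} {a = a} P? C (e∈P , ne∉P) fP a∉P Ca
  with a ≟ next e | P? (next a) | a ≟ next a
... | yes a≡ne | _        | _       = inj₁ a≡ne
... | no  _    | yes na∈P | _       = inj₂ (entry! C (a∉P , na∈P) fP)
-- A letter fixed by `next` is the only letter of the cycle, so it would be `e`.
... | no  _    | no  _    | yes a≡na =
  contradiction (subst P (sym (next-induction {P = a ≡_} closed refl e)) e∈P) a∉P
  where
  closed : ∀ x → a ≡ x → a ≡ next x
  closed _ refl = a≡na
... | no  a≢ne | no  na∉P | no a≢na =
  contradiction (subst P (exit! Ca (inj₁ e∈P , [ ne∉P , a≢ne ]′)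
                                   (inj₂ refl , [ na∉P , a≢na ]′)) e∈P) a∉P

-- If the two ends met in `f`, the letters outside `P` other than `f` would be closed under `next`;
-- containing `b`, they would contain `f` as well.
next-exit≢entry : e ∈ Exit P → Cyclic P → f ∈ Entry P → b ∉ P → b ≢ f → next e ≢ f
next-exit≢entry {e = e} {P = P} {f = f} (e∈P , _) C fP b∉P b≢f ne≡f =
  proj₂ (next-induction {P = λ x → x ∉ P × x ≢ f} closed (b∉P , b≢f) f) refl
  where
  closed : ∀ x → x ∉ P × x ≢ f → next x ∉ P × next x ≢ f
  closed x (x∉P , x≢f) =
    (λ nx∈P → x≢f (entry! C (x∉P , nx∈P) fP)) ,
    (λ nx≡f → x∉P (subst P (next-injective (trans ne≡f (sym nx≡f))) e∈P))

module Addable (P? : Decidable P) (C : Cyclic P) (∃P : Satisfiable P) where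

  -- Each addable letter is one of the two ends, so among three of them two coincide.
  not-three : a ∉ P → b ∉ P → c ∉ P → a ≢ b → a ≢ c → b ≢ c →
              Cyclic (P ∪ ｛ a ｝) → Cyclic (P ∪ ｛ b ｝) → ¬ Cyclic (P ∪ ｛ c ｝)
  not-three a∉P b∉P c∉P a≢b a≢c b≢c Ca Cb Cc
    with ∃-exit P? (proj₂ ∃P) a∉P | ∃-entry P? (proj₂ ∃P) a∉P
  ... | e , eP | f , fP
    with addable-cases P? C eP fP a∉P Ca
       | addable-cases P? C eP fP b∉P Cb
       | addable-cases P? C eP fP c∉P Cc
  ... | inj₁ refl | inj₁ refl | _         = a≢b refl
  ... | inj₂ refl | inj₂ refl | _         = a≢b refl
  ... | inj₁ refl | inj₂ refl | inj₁ refl = a≢c refl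
  ... | inj₁ refl | inj₂ refl | inj₂ refl = b≢c refl
  ... | inj₂ refl | inj₁ refl | inj₁ refl = b≢c refl
  ... | inj₂ refl | inj₁ refl | inj₂ refl = a≢c refl

  -- A second letter `b` outside `P` keeps the two ends apart, so the end other than `a` can serve
  -- as `l`.
  another : a ∉ P → b ∉ P → a ≢ b → Cyclic (P ∪ ｛ a ｝) →
            ∃ λ l → l ∉ P × l ≢ a × Cyclic (P ∪ ｛ l ｝)
  another {a = a} {b = b} a∉P b∉P a≢b Ca
    with ∃-exit P? (proj₂ ∃P) a∉P | ∃-entry P? (proj₂ ∃P) a∉P
  ... | e , eP | f , fP with addable-cases P? C eP fP a∉P Ca
  ...   | inj₂ refl =
    next e , proj₂ eP , next-exit≢entry eP C fP b∉P (≢-sym a≢b) , add-after-exit C eP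
  ...   | inj₁ refl = f , proj₁ fP , ≢-sym ne≢f , add-at-entry C fP
    where
    ne≢f : next e ≢ f
    ne≢f ne≡f = next-exit≢entry eP C fP b∉P (λ b≡f → a≢b (trans ne≡f (sym b≡f))) ne≡f

  -- The two letters sit at opposite ends of `P`; adding the one after the exit leaves the other at
  -- the entry.
  both : a ∉ P → b ∉ P → a ≢ b →
         Cyclic (P ∪ ｛ a ｝) → Cyclic (P ∪ ｛ b ｝) → Cyclic ((P ∪ ｛ a ｝) ∪ ｛ b ｝)
  both {a = a} {b = b} a∉P b∉P a≢b Ca Cb
    with ∃-exit P? (proj₂ ∃P) a∉P | ∃-entry P? (proj₂ ∃P) a∉P
  ... | e , eP | f , fP
    with addable-cases P? C eP fP a∉P Ca | addable-cases P? C eP fP b∉P Cb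
  ... | inj₁ refl | inj₁ refl = contradiction refl a≢b
  ... | inj₂ refl | inj₂ refl = contradiction refl a≢b
  ... | inj₁ refl | inj₂ refl =
    add-at-entry Ca ([ proj₁ fP , a≢b ]′ , inj₁ (proj₂ fP))
  ... | inj₂ refl | inj₁ refl =
    Cyclic-resp-≐ (exchange , exchange)
      (add-at-entry Cb ([ proj₁ fP , ≢-sym a≢b ]′ , inj₁ (proj₂ fP)))
    where
    exchange : ∀ {x y} → (P ∪ ｛ x ｝) ∪ ｛ y ｝ ⊆ (P ∪ ｛ y ｝) ∪ ｛ x ｝
    exchange = [ [ inj₁ ∘ inj₁ , inj₂ ]′ , inj₁ ∘ inj₂ ]′

-- Three letters between a prefix and a suffix

record Split (P R : Pred (Fin (ℕ.suc k)) 0ℓ) (x y z : Fin (ℕ.suc k)) : Set where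
  field
    P?    : Decidable P
    R?    : Decidable R
    P∩R=∅ : ∀ {w} → w ∈ P → w ∉ R
    x∉P   : x ∉ P
    y∉P   : y ∉ P
    z∉P   : z ∉ P
    x∉R   : x ∉ R
    y∉R   : y ∉ R
    z∉R   : z ∉ R
    x≢y   : x ≢ y
    x≢z   : x ≢ z
    y≢z   : y ≢ z
    cover : ∀ w → w ∈ P ⊎ w ≡ x ⊎ w ≡ y ⊎ w ≡ z ⊎ w ∈ R

-- Reading the permutation backwards: each fact about `P` gives one about `R`.
flip : Split P R x y z → Split R P z y x
flip S = record
  { P?    = R?
  ; R?    = P?
  ; P∩R=∅ = λ w∈R w∈P → P∩R=∅ w∈P w∈R
  ; x∉P   = z∉R
  ; y∉P   = y∉R
  ; z∉P   = x∉R
  ; x∉R   = z∉P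
  ; y∉R   = y∉P
  ; z∉R   = x∉P
  ; x≢y   = ≢-sym y≢z
  ; x≢z   = ≢-sym x≢z
  ; y≢z   = ≢-sym x≢y
  ; cover = λ w → [ inj₂ ∘ inj₂ ∘ inj₂ ∘ inj₂
                  , [ inj₂ ∘ inj₂ ∘ inj₂ ∘ inj₁
                    , [ inj₂ ∘ inj₂ ∘ inj₁ , [ inj₂ ∘ inj₁ , inj₁ ]′ ]′ ]′ ]′ (cover w)
  }
  where open Split S

swapˡ : Split P R x y z → Split P R y x z
swapˡ S = record
  { P?    = P?
  ; R?    = R?
  ; P∩R=∅ = P∩R=∅
  ; x∉P   = y∉P
  ; y∉P   = x∉P
  ; z∉P   = z∉P
  ; x∉R   = y∉R
  ; y∉R   = x∉R
  ; z∉R   = z∉R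
  ; x≢y   = ≢-sym x≢y
  ; x≢z   = y≢z
  ; y≢z   = x≢z
  ; cover = λ w → Sum.map₂ [ inj₂ ∘ inj₁ , [ inj₁ , inj₂ ∘ inj₂ ]′ ]′ (cover w)
  }
  where open Split S

swapʳ : Split P R x y z → Split P R x z y
swapʳ = flip ∘ swapˡ ∘ flip

module _ (S : Split P R x y z) where
  open Split S

  private
    complement : R ∪ ｛ z ｝ ≐ ∁ ((P ∪ ｛ x ｝) ∪ ｛ y ｝)
    complement = R∪z⊆ , ⊆R∪z
      where
      R∪z⊆ : R ∪ ｛ z ｝ ⊆ ∁ ((P ∪ ｛ x ｝) ∪ ｛ y ｝)
      R∪z⊆ (inj₁ w∈R)  = [ [ (λ w∈P → P∩R=∅ w∈P w∈R) , (λ { refl → x∉R w∈R }) ]′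
                         , (λ { refl → y∉R w∈R }) ]′
      R∪z⊆ (inj₂ refl) = [ [ z∉P , x≢z ]′ , y≢z ]′

      ⊆R∪z : ∁ ((P ∪ ｛ x ｝) ∪ ｛ y ｝) ⊆ R ∪ ｛ z ｝
      ⊆R∪z {w} w∉ with cover w
      ... | inj₁ w∈P                       = contradiction (inj₁ (inj₁ w∈P)) w∉
      ... | inj₂ (inj₁ w≡x)                = contradiction (inj₁ (inj₂ (sym w≡x))) w∉
      ... | inj₂ (inj₂ (inj₁ w≡y))         = contradiction (inj₂ (sym w≡y)) w∉
      ... | inj₂ (inj₂ (inj₂ (inj₁ w≡z))) = inj₂ (sym w≡z)
      ... | inj₂ (inj₂ (inj₂ (inj₂ w∈R))) = inj₁ w∈R

    Pxy? : Decidable ((P ∪ ｛ x ｝) ∪ ｛ y ｝)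
    Pxy? = (P? ∪? (x ≟_)) ∪? (y ≟_)

  -- Complementation exchanges exits and entries. Exchanging the last two letters creates the prefix
  -- `(P ∪ ｛ x ｝) ∪ ｛ z ｝`; through `swapʳ` the condition on it becomes one on `R ∪ ｛ y ｝`.
  to-suffix : Cyclic ((P ∪ ｛ x ｝) ∪ ｛ y ｝) → Cyclic (R ∪ ｛ z ｝)
  to-suffix = Cyclic-resp-≐ (≐-sym complement) ∘ Cyclic-∁ Pxy?

  from-suffix : Cyclic (R ∪ ｛ z ｝) → Cyclic ((P ∪ ｛ x ｝) ∪ ｛ y ｝)
  from-suffix C = Cyclic-resp-≐
    ((λ {w} → decidable-stable (Pxy? w)) , λ w∈ w∉ → w∉ w∈)
    (Cyclic-∁ (∁? Pxy?) (Cyclic-resp-≐ complement C))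

  module _ (C : Cyclic P) (∃P : Satisfiable P) where
    open Addable P? C ∃P

    not-all : Cyclic (P ∪ ｛ x ｝) → Cyclic (P ∪ ｛ y ｝) → ¬ Cyclic (P ∪ ｛ z ｝)
    not-all = not-three x∉P y∉P z∉P x≢y x≢z y≢z

    two⇒third : Cyclic (P ∪ ｛ x ｝) → Cyclic (P ∪ ｛ y ｝) → Cyclic (R ∪ ｛ z ｝)
    two⇒third Cx Cy = to-suffix (both x∉P y∉P x≢y Cx Cy)

-- If neither y nor z can be added to P, then the end of P other than x lies
-- in R, and P ∪ {x} would have three elements that can be added to it.
spread : Split P R x y z → Cyclic P → Satisfiable P → Cyclic (P ∪ ｛ x ｝) →
         Cyclic (R ∪ ｛ z ｝) → Cyclic (R ∪ ｛ y ｝) →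
         Cyclic (P ∪ ｛ y ｝) ⊎ Cyclic (P ∪ ｛ z ｝)
spread {x = x} S C ∃P Cx Rz Ry with Addable.another P? C ∃P x∉P y∉P x≢y Cx
  where open Split S
... | l , l∉P , l≢x , Cl with Split.cover S l
...   | inj₁ l∈P                       = contradiction l∈P l∉P
...   | inj₂ (inj₁ l≡x)                = contradiction l≡x l≢x
...   | inj₂ (inj₂ (inj₁ refl))        = inj₁ Cl
...   | inj₂ (inj₂ (inj₂ (inj₁ refl))) = inj₂ Cl
...   | inj₂ (inj₂ (inj₂ (inj₂ l∈R))) =
  contradiction (Addable.both P? C ∃P x∉P l∉P (≢-sym l≢x) Cx Cl)
    (Addable.not-three (P? ∪? (x ≟_)) Cx (x , inj₂ refl)
      [ y∉P , x≢y ]′ [ z∉P , x≢z ]′ [ l∉P , ≢-sym l≢x ]′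
      y≢z (λ { refl → y∉R l∈R }) (λ { refl → z∉R l∈R })
      (from-suffix S Rz) (from-suffix (swapʳ S) Ry))
  where open Split S

-- Any single letter can be added to an empty `R`, so both conditions of `spread` on `R` are met.
one-more : Split P R x y z → (∀ w → w ∉ R) → Cyclic P → Satisfiable P →
              Cyclic (P ∪ ｛ x ｝) → Cyclic (P ∪ ｛ y ｝) ⊎ Cyclic (P ∪ ｛ z ｝)
one-more S R=∅ C ∃P Cx =
  spread S C ∃P Cx (Cyclic-singleton R=∅) (Cyclic-singleton R=∅)

-- Adjacent transpositions and prefixes

inject₁≢suc : (j : Fin m) → inject₁ j ≢ suc j
inject₁≢suc (suc j) eq = inject₁≢suc j (suc-injective eq)

module _ (σ : Permutation′ (ℕ.suc m)) (j : Fin m) where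

  ·σ-inject₁ : σ ·σ j ⟨$⟩ʳ inject₁ j ≡ σ ⟨$⟩ʳ suc j
  ·σ-inject₁ rewrite dec-true (inject₁ j ≟ inject₁ j) refl = refl

  ·σ-suc : σ ·σ j ⟨$⟩ʳ suc j ≡ σ ⟨$⟩ʳ inject₁ j
  ·σ-suc rewrite dec-false (suc j ≟ inject₁ j) (≢-sym (inject₁≢suc j))
               | dec-true (suc j ≟ suc j) refl = refl

  ·σ-other : ∀ {t} → t ≢ inject₁ j → t ≢ suc j → σ ·σ j ⟨$⟩ʳ t ≡ σ ⟨$⟩ʳ t
  ·σ-other {t} t≢ t≢′
    rewrite dec-false (t ≟ inject₁ j) t≢ | dec-false (t ≟ suc j) t≢′ = refl

data Place (j : Fin m) : Fin (ℕ.suc m) → Set where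
  left  : Place j (inject₁ j)
  right : Place j (suc j)
  other : ∀ {t} → t ≢ inject₁ j → t ≢ suc j → Place j t

place : (j : Fin m) (t : Fin (ℕ.suc m)) → Place j t
place j t with t ≟ inject₁ j | t ≟ suc j
... | yes refl | _        = left
... | no _     | yes refl = right
... | no t≢    | no t≢′   = other t≢ t≢′

·σ-cong : (σ τ : Permutation′ (ℕ.suc m)) (j : Fin m) → σ ≈ₚ τ → σ ·σ j ≈ₚ τ ·σ j
·σ-cong σ τ j eq _ = eq _

·σ-involutive : (σ : Permutation′ (ℕ.suc m)) (j : Fin m) → (σ ·σ j) ·σ j ≈ₚ σ
·σ-involutive σ j t with place j t
... | left         = trans (·σ-inject₁ (σ ·σ j) j) (·σ-suc σ j)
... | right        = trans (·σ-suc (σ ·σ j) j) (·σ-inject₁ σ j)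
... | other t≢ t≢′ = trans (·σ-other (σ ·σ j) j t≢ t≢′) (·σ-other σ j t≢ t≢′)

-- Both bounds are strict, so `Prefix σ i` and `Suffix σ (2 + i)` leave out exactly the positions
-- `i`, `i + 1` and `i + 2`.
Prefix Suffix : Permutation′ n → ℕ → Pred (Fin n) 0ℓ
Prefix σ k x = ∃ λ t → toℕ t ℕ.< k × σ ⟨$⟩ʳ t ≡ x
Suffix σ k x = ∃ λ t → k ℕ.< toℕ t × σ ⟨$⟩ʳ t ≡ x

Prefix-cong : (σ τ : Permutation′ n) → (∀ t → toℕ t ℕ.< k → σ ⟨$⟩ʳ t ≡ τ ⟨$⟩ʳ t) →
              Prefix σ k ≐ Prefix τ k
Prefix-cong σ τ eq = (λ (t , t<k , σt≡x) → t , t<k , trans (sym (eq t t<k)) σt≡x)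
                   , (λ (t , t<k , τt≡x) → t , t<k , trans (eq t t<k) τt≡x)

letters≐Prefix : (σ : Permutation′ n) (j : Fin n) → letters σ j ≐ Prefix σ (ℕ.suc (toℕ j))
letters≐Prefix σ j = (λ (t , t≤j , eq) → t , ℕ.s≤s t≤j , eq)
                   , (λ (t , t<j , eq) → t , ℕ.≤-pred t<j , eq)

Prefix? : (σ : Permutation′ n) (k : ℕ) → Decidable (Prefix σ k)
Prefix? σ k x = any? λ t → toℕ t ℕ.<? k ×-dec σ ⟨$⟩ʳ t ≟ x

Suffix? : (σ : Permutation′ n) (k : ℕ) → Decidable (Suffix σ k)
Suffix? σ k x = any? λ t → k ℕ.<? toℕ t ×-dec σ ⟨$⟩ʳ t ≟ x

permutation-injective : (σ : Permutation′ n) → ∀ {t u} → σ ⟨$⟩ʳ t ≡ σ ⟨$⟩ʳ u → t ≡ u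
permutation-injective σ eq =
  trans (sym (from-to σ)) (trans (cong (σ ⟨$⟩ˡ_) eq) (from-to σ))

∈Prefix⇒< : (σ : Permutation′ n) → ∀ {t} → σ ⟨$⟩ʳ t ∈ Prefix σ k → toℕ t ℕ.< k
∈Prefix⇒< {k = k} σ (u , u<k , eq) =
  subst (λ v → toℕ v ℕ.< k) (permutation-injective σ eq) u<k

∈Suffix⇒> : (σ : Permutation′ n) → ∀ {t} → σ ⟨$⟩ʳ t ∈ Suffix σ k → k ℕ.< toℕ t
∈Suffix⇒> {k = k} σ (u , u>k , eq) =
  subst (λ v → k ℕ.< toℕ v) (permutation-injective σ eq) u>k

Suffix≐∁Prefix : (σ : Permutation′ n) (k : ℕ) → Suffix σ k ≐ ∁ (Prefix σ (ℕ.suc k))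
Suffix≐∁Prefix σ k =
  (λ { (t , k<t , refl) t∈ → ℕ.<⇒≱ k<t (ℕ.≤-pred (∈Prefix⇒< σ t∈)) }) ,
  (λ {x} x∉ → σ ⟨$⟩ˡ x , ℕ.≰⇒> (λ t≤k → x∉ (σ ⟨$⟩ˡ x , ℕ.s≤s t≤k , to-from σ)) , to-from σ)

Prefix-suc : (σ : Permutation′ n) (t : Fin n) →
             Prefix σ (ℕ.suc (toℕ t)) ≐ Prefix σ (toℕ t) ∪ ｛ σ ⟨$⟩ʳ t ｝
Prefix-suc σ t = ⊆-∪ , [ (λ (u , u<t , eq) → u , ℕ.m<n⇒m<1+n u<t , eq)
                       , (λ eq → t , ℕ.≤-refl , eq) ]′
  where
  ⊆-∪ : Prefix σ (ℕ.suc (toℕ t)) ⊆ Prefix σ (toℕ t) ∪ ｛ σ ⟨$⟩ʳ t ｝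
  ⊆-∪ (u , u<1+t , refl) with ℕ.m≤n⇒m<n∨m≡n (ℕ.≤-pred u<1+t)
  ... | inj₁ u<t = inj₁ (u , u<t , refl)
  ... | inj₂ u≡t = inj₂ (cong (σ ⟨$⟩ʳ_) (sym (toℕ-injective u≡t)))

-- Length zero and lengths beyond the number of letters, on which `IsArc` is silent, give the empty
-- and the full set.
IsArc⇒Cyclic-Prefix : (σ : Permutation′ (ℕ.suc m)) → IsArc σ → ∀ k → Cyclic (Prefix σ k)
IsArc⇒Cyclic-Prefix σ arc ℕ.zero = Cyclic-empty λ { _ (_ , () , _) }
IsArc⇒Cyclic-Prefix {m = m} σ arc (ℕ.suc k) with k ℕ.<? ℕ.suc m
... | yes k<n = subst (λ l → Cyclic (Prefix σ (ℕ.suc l))) (toℕ-fromℕ< k<n)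
  (Cyclic-resp-≐ (letters≐Prefix σ (fromℕ< k<n)) (IsInterval⇒Cyclic (arc (fromℕ< k<n))))
... | no  k≮n = Cyclic-full λ x → σ ⟨$⟩ˡ x
  , ℕ.m≤n⇒m≤1+n (ℕ.≤-trans (toℕ<n (σ ⟨$⟩ˡ x)) (ℕ.≮⇒≥ k≮n)) , to-from σ

Cyclic-Prefix⇒IsArc : (σ : Permutation′ (ℕ.suc m)) → (∀ k → Cyclic (Prefix σ k)) → IsArc σ
Cyclic-Prefix⇒IsArc σ C j = Cyclic⇒IsInterval
  (λ x → any? λ t → t ≤? j ×-dec σ ⟨$⟩ʳ t ≟ x)
  (σ ⟨$⟩ʳ j , j , ≤-refl , refl)
  (Cyclic-resp-≐ (≐-sym (letters≐Prefix σ j)) (C (ℕ.suc (toℕ j))))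

IsArc-resp-≈ : (σ τ : Permutation′ (ℕ.suc m)) → σ ≈ₚ τ → IsArc σ → IsArc τ
IsArc-resp-≈ σ τ eq arc = Cyclic-Prefix⇒IsArc τ λ k →
  Cyclic-resp-≐ (Prefix-cong σ τ λ t _ → eq t) (IsArc⇒Cyclic-Prefix σ arc k)

-- This is the one prefix that the exchange alters, in its altered form; for an arc permutation it
-- alone decides whether the result is one.
Swappable : Permutation′ (ℕ.suc m) → Fin m → Set
Swappable σ j = Cyclic (Prefix σ (toℕ j) ∪ ｛ σ ⟨$⟩ʳ suc j ｝)

swappable? : (σ : Permutation′ (ℕ.suc m)) (j : Fin m) → Dec (Swappable σ j)
swappable? σ j = cyclic? (Prefix? σ (toℕ j) ∪? (σ ⟨$⟩ʳ suc j ≟_)) (_ , inj₂ refl)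

module _ (σ : Permutation′ (ℕ.suc m)) (j : Fin m) where

  -- A prefix of any other length contains both exchanged positions or neither.
  Prefix-·σ-≢ : k ≢ ℕ.suc (toℕ j) → Prefix (σ ·σ j) k ≐ Prefix σ k
  Prefix-·σ-≢ {k = k} k≢ = ⊆σ , σ⊆
    where
    left⇒right : toℕ (inject₁ j) ℕ.< k → toℕ (suc j) ℕ.< k
    left⇒right j<k =
      ℕ.≤∧≢⇒< (subst (λ l → ℕ.suc l ℕ.≤ k) (toℕ-inject₁ j) j<k) (≢-sym k≢)

    right⇒left : toℕ (suc j) ℕ.< k → toℕ (inject₁ j) ℕ.< k
    right⇒left j<k = subst (ℕ._< k) (sym (toℕ-inject₁ j)) (ℕ.<⇒≤ j<k)

    ⊆σ : Prefix (σ ·σ j) k ⊆ Prefix σ k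
    ⊆σ (t , t<k , eq) with place j t
    ... | left         = suc j , left⇒right t<k , trans (sym (·σ-inject₁ σ j)) eq
    ... | right        = inject₁ j , right⇒left t<k , trans (sym (·σ-suc σ j)) eq
    ... | other t≢ t≢′ = t , t<k , trans (sym (·σ-other σ j t≢ t≢′)) eq

    σ⊆ : Prefix σ k ⊆ Prefix (σ ·σ j) k
    σ⊆ (t , t<k , eq) with place j t
    ... | left         = suc j , left⇒right t<k , trans (·σ-suc σ j) eq
    ... | right        = inject₁ j , right⇒left t<k , trans (·σ-inject₁ σ j) eq
    ... | other t≢ t≢′ = t , t<k , trans (·σ-other σ j t≢ t≢′) eq

  Prefix-·σ : Prefix (σ ·σ j) (ℕ.suc (toℕ j)) ≐ Prefix σ (toℕ j) ∪ ｛ σ ⟨$⟩ʳ suc j ｝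
  Prefix-·σ = subst₂ (λ l x → Prefix (σ ·σ j) (ℕ.suc l) ≐ Prefix σ l ∪ ｛ x ｝)
    (toℕ-inject₁ j) (·σ-inject₁ σ j)
    (≐-trans (Prefix-suc (σ ·σ j) (inject₁ j))
             ( Sum.map₁ (proj₁ same) , Sum.map₁ (proj₂ same)))
    where
    same : Prefix (σ ·σ j) (toℕ (inject₁ j)) ≐ Prefix σ (toℕ (inject₁ j))
    same = Prefix-·σ-≢ (λ eq → ℕ.1+n≢n (trans (sym eq) (toℕ-inject₁ j)))

  IsArc-·σ⇒Swappable : IsArc (σ ·σ j) → Swappable σ j
  IsArc-·σ⇒Swappable arc =
    Cyclic-resp-≐ Prefix-·σ (IsArc⇒Cyclic-Prefix (σ ·σ j) arc (ℕ.suc (toℕ j)))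

  Swappable⇒IsArc-·σ : IsArc σ → Swappable σ j → IsArc (σ ·σ j)
  Swappable⇒IsArc-·σ arc swappable = Cyclic-Prefix⇒IsArc (σ ·σ j) cyclic
    where
    cyclic : ∀ k → Cyclic (Prefix (σ ·σ j) k)
    cyclic k with k ℕ.≟ ℕ.suc (toℕ j)
    ... | yes refl = Cyclic-resp-≐ (≐-sym Prefix-·σ) swappable
    ... | no  k≢   = Cyclic-resp-≐ (≐-sym (Prefix-·σ-≢ k≢)) (IsArc⇒Cyclic-Prefix σ arc k)

module _ (j : Fin m) (π : ArcPermutation (ℕ.suc m)) where

  ρ-swap : Swappable (perm π) j → perm (ρ j π) ≈ₚ perm π ·σ j
  ρ-swap swappable with isArc? (perm π ·σ j)
  ... | yes _    = λ _ → refl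
  ... | no  ¬arc = contradiction (Swappable⇒IsArc-·σ (perm π) j (isArc π) swappable) ¬arc

  ρ-fix : ¬ Swappable (perm π) j → perm (ρ j π) ≈ₚ perm π
  ρ-fix ¬swappable with isArc? (perm π ·σ j)
  ... | yes arc = contradiction (IsArc-·σ⇒Swappable (perm π) j arc) ¬swappable
  ... | no  _   = λ _ → refl

Swappable-resp-≈ : (j : Fin m) (σ τ : Permutation′ (ℕ.suc m)) → σ ≈ₚ τ →
                   Swappable σ j → Swappable τ j
Swappable-resp-≈ j σ τ eq = Cyclic-resp-≐
  ( Sum.map (proj₁ same) (trans (sym (eq (suc j))))
  , Sum.map (proj₂ same) (trans (eq (suc j))))
  where
  same : Prefix σ (toℕ j) ≐ Prefix τ (toℕ j)
  same = Prefix-cong σ τ λ t _ → eq t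

-- Exchanges at disjoint pairs of positions

Far : Fin m → Fin m → Set
Far i j = ℕ.suc (toℕ i) ℕ.< toℕ j ⊎ ℕ.suc (toℕ j) ℕ.< toℕ i

module _ {i j : Fin m} where

  Far-sym : Far i j → Far j i
  Far-sym = Sum.swap

  Far⇒suc≢inject₁ : Far i j → suc i ≢ inject₁ j
  Far⇒suc≢inject₁ far eq = [ (λ lt → ℕ.<⇒≢ lt eq′) , (λ lt → ℕ.<⇒≢ (ℕ.<-trans (ℕ.n<1+n _) (ℕ.<-trans lt (ℕ.n<1+n _))) (sym eq′)) ]′ far
    where
    eq′ : ℕ.suc (toℕ i) ≡ toℕ j
    eq′ = trans (cong toℕ eq) (toℕ-inject₁ j)

  Far⇒≢ : Far i j → i ≢ j
  Far⇒≢ far refl = [ (λ lt → ℕ.1+n≰n (ℕ.<⇒≤ lt)) , (λ lt → ℕ.1+n≰n (ℕ.<⇒≤ lt)) ]′ far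

·σ-inject₁-far : (σ : Permutation′ (ℕ.suc m)) {i j : Fin m} → Far i j →
                 σ ·σ j ⟨$⟩ʳ inject₁ i ≡ σ ⟨$⟩ʳ inject₁ i
·σ-inject₁-far σ {i} {j} far = ·σ-other σ j
  (Far⇒≢ far ∘ inject₁-injective) (≢-sym (Far⇒suc≢inject₁ (Far-sym far)))

·σ-suc-far : (σ : Permutation′ (ℕ.suc m)) {i j : Fin m} → Far i j →
             σ ·σ j ⟨$⟩ʳ suc i ≡ σ ⟨$⟩ʳ suc i
·σ-suc-far σ {i} {j} far = ·σ-other σ j (Far⇒suc≢inject₁ far) (Far⇒≢ far ∘ suc-injective)

-- The exchange at `j` happens entirely inside or entirely outside the prefix of length `toℕ i`, and
-- does not touch position `suc i`.
Swappable-far : (σ : Permutation′ (ℕ.suc m)) {i j : Fin m} → Far i j →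
                Swappable σ i → Swappable (σ ·σ j) i
Swappable-far σ {i} {j} far = Cyclic-resp-≐
  ( Sum.map (proj₂ same) (trans (·σ-suc-far σ far))
  , Sum.map (proj₁ same) (trans (sym (·σ-suc-far σ far))))
  where
  same : Prefix (σ ·σ j) (toℕ i) ≐ Prefix σ (toℕ i)
  same = Prefix-·σ-≢ σ j λ eq → Far⇒suc≢inject₁ (Far-sym far)
    (toℕ-injective (trans (sym eq) (sym (toℕ-inject₁ i))))

Swappable-far⁻ : (σ : Permutation′ (ℕ.suc m)) {i j : Fin m} → Far i j →
                 Swappable (σ ·σ j) i → Swappable σ i
Swappable-far⁻ σ {i} {j} far =
  Swappable-resp-≈ i ((σ ·σ j) ·σ j) σ (·σ-involutive σ j) ∘ Swappable-far (σ ·σ j) far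

module _ (σ : Permutation′ (ℕ.suc m)) where

  private
    near-left : {i j : Fin m} → Far i j → (σ ·σ i) ·σ j ⟨$⟩ʳ inject₁ i ≡ (σ ·σ j) ·σ i ⟨$⟩ʳ inject₁ i
    near-left {i} {j} far = trans (trans (·σ-inject₁-far (σ ·σ i) far) (·σ-inject₁ σ i))
      (sym (trans (·σ-inject₁ (σ ·σ j) i) (·σ-suc-far σ far)))

    near-right : {i j : Fin m} → Far i j → (σ ·σ i) ·σ j ⟨$⟩ʳ suc i ≡ (σ ·σ j) ·σ i ⟨$⟩ʳ suc i
    near-right {i} {j} far = trans (trans (·σ-suc-far (σ ·σ i) far) (·σ-suc σ i))
      (sym (trans (·σ-suc (σ ·σ j) i) (·σ-inject₁-far σ far)))

  ·σ-comm : {i j : Fin m} → Far i j →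
            (σ ·σ i) ·σ j ≈ₚ (σ ·σ j) ·σ i
  ·σ-comm {i} {j} far t with place i t | place j t
  ... | left         | _            = near-left far
  ... | right        | _            = near-right far
  ... | other _ _    | left         = sym (near-left (Far-sym far))
  ... | other _ _    | right        = sym (near-right (Far-sym far))
  ... | other i≢ i≢′ | other j≢ j≢′ =
    trans (trans (·σ-other (σ ·σ i) j j≢ j≢′) (·σ-other σ i i≢ i≢′))
          (sym (trans (·σ-other (σ ·σ j) i i≢ i≢′) (·σ-other σ j j≢ j≢′)))

∣-∣>1⇒Far : ∀ {n} (i j : Fin n) → ∣ toℕ j - toℕ i ∣ ℕ.> 1 → Far i j
∣-∣>1⇒Far i j gap with ℕ.≤-total (toℕ i) (toℕ j)
... | inj₁ i≤j = inj₁ (ℕ.m≤o∸n⇒m+n≤o 2 i≤j (subst (2 ℕ.≤_) (ℕ.m≤n⇒∣n-m∣≡n∸m i≤j) gap))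
... | inj₂ j≤i = inj₂ (ℕ.m≤o∸n⇒m+n≤o 2 j≤i (subst (2 ℕ.≤_) (ℕ.m≤n⇒∣m-n∣≡n∸m j≤i) gap))

-- Actions generated by involutions

module Involutions {S : Set} (R : Pred (Word S) 0ℓ) (X : Setoid ℓ₁ ℓ₂)
  (f : S → Setoid.Carrier X → Setoid.Carrier X)
  (f-cong : ∀ i {x y} → Setoid._≈_ X x y → Setoid._≈_ X (f i x) (f i y))
  (f-involutive : ∀ i x → Setoid._≈_ X (f i (f i x)) x)
  where
  private
    open module X = Setoid X using (Carrier; _≈_)

  -- Formal inverses act by running the word backwards, each generator being its own inverse.
  act act⁻¹ : Word S → Carrier → Carrier
  act (gen i) x = f i x
  act ε       x = x
  act (u ∙ v) x = act u (act v x)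
  act (w ⁻¹)  x = act⁻¹ w x
  act⁻¹ (gen i) x = f i x
  act⁻¹ ε       x = x
  act⁻¹ (u ∙ v) x = act⁻¹ v (act⁻¹ u x)
  act⁻¹ (w ⁻¹)  x = act w x

  act-cong   : ∀ w {x y} → x ≈ y → act w x ≈ act w y
  act⁻¹-cong : ∀ w {x y} → x ≈ y → act⁻¹ w x ≈ act⁻¹ w y
  act-cong (gen i) eq = f-cong i eq
  act-cong ε       eq = eq
  act-cong (u ∙ v) eq = act-cong u (act-cong v eq)
  act-cong (w ⁻¹)  eq = act⁻¹-cong w eq
  act⁻¹-cong (gen i) eq = f-cong i eq
  act⁻¹-cong ε       eq = eq
  act⁻¹-cong (u ∙ v) eq = act⁻¹-cong v (act⁻¹-cong u eq)
  act⁻¹-cong (w ⁻¹)  eq = act-cong w eq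

  act-act⁻¹ : ∀ w x → act w (act⁻¹ w x) ≈ x
  act⁻¹-act : ∀ w x → act⁻¹ w (act w x) ≈ x
  act-act⁻¹ (gen i) x = f-involutive i x
  act-act⁻¹ ε       x = X.refl
  act-act⁻¹ (u ∙ v) x = X.trans (act-cong u (act-act⁻¹ v _)) (act-act⁻¹ u x)
  act-act⁻¹ (w ⁻¹)  x = act⁻¹-act w x
  act⁻¹-act (gen i) x = f-involutive i x
  act⁻¹-act ε       x = X.refl
  act⁻¹-act (u ∙ v) x = X.trans (act⁻¹-cong v (act⁻¹-act u _)) (act⁻¹-act v x)
  act⁻¹-act (w ⁻¹)  x = act-act⁻¹ w x

  module _ (act-relator : ∀ {w} → R w → ∀ x → act w x ≈ x) where

    act-Equal : ∀ {u v} → Equal R u v → ∀ x → act u x ≈ act v x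
    act-Equal (relator r)             x = act-relator r x
    act-Equal reflᵉ                   x = X.refl
    act-Equal (symᵉ e)                x = X.sym (act-Equal e x)
    act-Equal (transᵉ e e′)           x = X.trans (act-Equal e x) (act-Equal e′ x)
    act-Equal (∙-cong {u} {v} {w} e e′) x = X.trans (act-cong u (act-Equal e′ x)) (act-Equal e _)
    -- Write `x` as `w` applied to `act⁻¹ w x`, replace that `w` by `v`, and cancel `v`.
    act-Equal (⁻¹-cong {v} {w} e)     x = X.trans
      (act⁻¹-cong v (X.trans (X.sym (act-act⁻¹ w x)) (X.sym (act-Equal e _))))
      (act⁻¹-act v _)
    act-Equal (assoc u v w)           x = X.refl
    act-Equal (identityˡ w)           x = X.refl
    act-Equal (identityʳ w)           x = X.refl
    act-Equal (inverseˡ w)            x = act⁻¹-act w x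
    act-Equal (inverseʳ w)            x = act-act⁻¹ w x

    action : Action ⟨ S ∣ R ⟩ X
    action = record
      { _▷_        = act
      ; ▷-cong     = λ {g} e eq → X.trans (act-cong g eq) (act-Equal e _)
      ; ▷-identity = λ _ → X.refl
      ; ▷-compose  = λ _ _ _ → X.refl
      }

    action-unique : (β : Action ⟨ S ∣ R ⟩ X) → (∀ i x → Action._▷_ β (gen i) x ≈ f i x) →
                    action ≗ᵃ β
    action-unique β β-gen = agree
      where
      open Action β
      agree : ∀ w x → act w x ≈ (w ▷ x)
      agree (gen i) x = X.sym (β-gen i x)
      agree ε       x = X.sym (▷-identity x)
      agree (u ∙ v) x = X.trans (act-cong u (agree v x))
        (X.trans (agree u (v ▷ x)) (X.sym (▷-compose u v x)))
      -- By induction `β` lets `w` carry `act⁻¹ w x` to `x`; applying `w ⁻¹` under `β` to both sides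
      -- gives the claim.
      agree (w ⁻¹)  x = X.sym (X.trans (▷-cong reflᵉ (X.sym w▷w⁻¹x≈x))
        (X.trans (X.sym (▷-compose (w ⁻¹) w _))
        (X.trans (▷-cong (inverseˡ w) X.refl) (▷-identity _))))
        where
        w▷w⁻¹x≈x : (w ▷ act⁻¹ w x) ≈ x
        w▷w⁻¹x≈x = X.trans (X.sym (agree w _)) (act-act⁻¹ w x)

-- Three consecutive positions

module Triple {m : ℕ} (i : Fin m) where

  A B C : Fin (2 + m)
  A = inject₁ (inject₁ i)
  B = suc (inject₁ i)
  C = suc (suc i)

  toℕ-A : toℕ A ≡ toℕ i
  toℕ-A = trans (toℕ-inject₁ (inject₁ i)) (toℕ-inject₁ i)

  toℕ-B : toℕ B ≡ 1 + toℕ i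
  toℕ-B = cong ℕ.suc (toℕ-inject₁ i)

  i<B : toℕ i ℕ.< toℕ B
  i<B = ℕ.≤-reflexive (sym toℕ-B)

  B<C : toℕ B ℕ.< toℕ C
  B<C = ℕ.≤-reflexive (cong ℕ.suc toℕ-B)

  A≢B : A ≢ B
  A≢B eq = ℕ.<⇒≢ (subst (ℕ._< toℕ B) (sym toℕ-A) i<B) (cong toℕ eq)

  A≢C : A ≢ C
  A≢C eq = ℕ.<⇒≢ (subst (ℕ._< toℕ C) (sym toℕ-A) (ℕ.<-trans i<B B<C)) (cong toℕ eq)

  B≢C : B ≢ C
  B≢C eq = ℕ.<⇒≢ B<C (cong toℕ eq)

  Outside : Fin (2 + m) → Set
  Outside t = toℕ t ℕ.< toℕ i ⊎ 2 + toℕ i ℕ.< toℕ t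

  data Position : Fin (2 + m) → Set where
    atA     : Position A
    atB     : Position B
    atC     : Position C
    outside : ∀ {t} → Outside t → Position t

  position : ∀ t → Position t
  position t with ℕ.<-cmp (toℕ t) (1 + toℕ i)
  ... | tri≈ _ eq _ = subst Position (toℕ-injective (trans toℕ-B (sym eq))) atB
  ... | tri< t<1+i _ _ with ℕ.m≤n⇒m<n∨m≡n (ℕ.≤-pred t<1+i)
  ...   | inj₁ t<i = outside (inj₁ t<i)
  ...   | inj₂ t≡i = subst Position (toℕ-injective (trans toℕ-A (sym t≡i))) atA
  position t | tri> _ _ 1+i<t with ℕ.m≤n⇒m<n∨m≡n 1+i<t
  ...   | inj₁ 2+i<t = outside (inj₂ 2+i<t)
  ...   | inj₂ 2+i≡t = subst Position (toℕ-injective 2+i≡t) atC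

  A-inside : ¬ Outside A
  A-inside = [ (λ lt → ℕ.<⇒≢ lt toℕ-A) , (λ lt → ℕ.<⇒≱ (ℕ.<-trans (ℕ.n<1+n _) lt)
               (ℕ.m≤n⇒m≤1+n (ℕ.≤-reflexive toℕ-A))) ]′

  B-inside : ¬ Outside B
  B-inside = [ ℕ.<-asym i<B , ℕ.<-asym B<C ]′

  C-inside : ¬ Outside C
  C-inside = [ ℕ.<-asym (ℕ.<-trans i<B B<C) , ℕ.<-irrefl refl ]′

  split : (σ : Permutation′ (2 + m)) →
          Split (Prefix σ (toℕ i)) (Suffix σ (2 + toℕ i))
                (σ ⟨$⟩ʳ A) (σ ⟨$⟩ʳ B) (σ ⟨$⟩ʳ C)
  split σ = record
    { P?    = Prefix? σ (toℕ i)
    ; R?    = Suffix? σ (2 + toℕ i)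
    ; P∩R=∅ = λ { (t , t<i , refl) t∈ →
                  ℕ.<-asym t<i (ℕ.<-trans (ℕ.m<n+m _ ℕ.z<s) (∈Suffix⇒> σ t∈)) }
    ; x∉P   = A-inside ∘ inj₁ ∘ ∈Prefix⇒< σ
    ; y∉P   = B-inside ∘ inj₁ ∘ ∈Prefix⇒< σ
    ; z∉P   = C-inside ∘ inj₁ ∘ ∈Prefix⇒< σ
    ; x∉R   = A-inside ∘ inj₂ ∘ ∈Suffix⇒> σ
    ; y∉R   = B-inside ∘ inj₂ ∘ ∈Suffix⇒> σ
    ; z∉R   = C-inside ∘ inj₂ ∘ ∈Suffix⇒> σ
    ; x≢y   = A≢B ∘ permutation-injective σ
    ; x≢z   = A≢C ∘ permutation-injective σ
    ; y≢z   = B≢C ∘ permutation-injective σ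
    ; cover = λ w → go w (position (σ ⟨$⟩ˡ w)) (to-from σ)
    }
    where
    go : ∀ w {t} → Position t → σ ⟨$⟩ʳ t ≡ w →
         w ∈ Prefix σ (toℕ i) ⊎ w ≡ σ ⟨$⟩ʳ A ⊎ w ≡ σ ⟨$⟩ʳ B ⊎ w ≡ σ ⟨$⟩ʳ C ⊎
         w ∈ Suffix σ (2 + toℕ i)
    go w     atA                  eq = inj₂ (inj₁ (sym eq))
    go w     atB                  eq = inj₂ (inj₂ (inj₁ (sym eq)))
    go w     atC                  eq = inj₂ (inj₂ (inj₂ (inj₁ (sym eq))))
    go w {t} (outside (inj₁ t<i)) eq = inj₁ (t , t<i , eq)
    go w {t} (outside (inj₂ i<t)) eq = inj₂ (inj₂ (inj₂ (inj₂ (t , i<t , eq))))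

  Prefix-B : (σ : Permutation′ (2 + m)) →
             Prefix σ (1 + toℕ i) ≐ Prefix σ (toℕ i) ∪ ｛ σ ⟨$⟩ʳ A ｝
  Prefix-B σ = subst (λ l → Prefix σ (1 + l) ≐ Prefix σ l ∪ ｛ σ ⟨$⟩ʳ A ｝) toℕ-A (Prefix-suc σ A)

  Prefix-C : (σ : Permutation′ (2 + m)) →
             Prefix σ (2 + toℕ i) ≐ (Prefix σ (toℕ i) ∪ ｛ σ ⟨$⟩ʳ A ｝) ∪ ｛ σ ⟨$⟩ʳ B ｝
  Prefix-C σ = ≐-trans
    (subst (λ l → Prefix σ (1 + l) ≐ Prefix σ l ∪ ｛ σ ⟨$⟩ʳ B ｝) toℕ-B (Prefix-suc σ B))
    (Sum.map₁ (proj₁ (Prefix-B σ)) , Sum.map₁ (proj₂ (Prefix-B σ)))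

  module _ (σ : Permutation′ (2 + m)) where

    Swappable-lo : Swappable σ (inject₁ i) ≡ Cyclic (Prefix σ (toℕ i) ∪ ｛ σ ⟨$⟩ʳ B ｝)
    Swappable-lo = cong (λ l → Cyclic (Prefix σ l ∪ ｛ σ ⟨$⟩ʳ B ｝)) (toℕ-inject₁ i)

    private
      Prefix-hi : Prefix σ (toℕ (suc i)) ∪ ｛ σ ⟨$⟩ʳ C ｝ ≐
                  (Prefix σ (toℕ i) ∪ ｛ σ ⟨$⟩ʳ A ｝) ∪ ｛ σ ⟨$⟩ʳ C ｝
      Prefix-hi = Sum.map₁ (proj₁ (Prefix-B σ)) , Sum.map₁ (proj₂ (Prefix-B σ))

    Swappable-hi : Cyclic (Suffix σ (2 + toℕ i) ∪ ｛ σ ⟨$⟩ʳ B ｝) → Swappable σ (suc i)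
    Swappable-hi = Cyclic-resp-≐ (≐-sym Prefix-hi) ∘ from-suffix (swapʳ (split σ))

    Swappable-hi⁻ : Swappable σ (suc i) → Cyclic (Suffix σ (2 + toℕ i) ∪ ｛ σ ⟨$⟩ʳ B ｝)
    Swappable-hi⁻ = to-suffix (swapʳ (split σ)) ∘ Cyclic-resp-≐ Prefix-hi

  -- An ordering of the three letters in positions A, B, C of a fixed
  -- permutation, where 0F, 1F, 2F stand for their original order.
  Order : Set
  Order = Fin 3 × Fin 3 × Fin 3

  -- The sets before and after the triple are the same for all orderings, so the middle letter alone
  -- decides: `p t` and `q t` tell whether `t` can be added to the former and to the latter.
  lo hi : (Fin 3 → Bool) → Order → Order
  lo p (x , y , z) = if p y then (y , x , z) else (x , y , z)
  hi q (x , y , z) = if q y then (x , z , y) else (x , y , z)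

  orbit : (p q : Fin 3 → Bool) → ℕ → Order
  orbit p q ℕ.zero    = 0F , 1F , 2F
  orbit p q (ℕ.suc k) = lo p (hi q (orbit p q k))

-- f stands for ρ; the abstraction keeps isArc? from being unfolded.
module Moves {m : ℕ} (f : Fin (ℕ.suc m) → ArcPermutation (2 + m) → ArcPermutation (2 + m))
  (f-swap : ∀ j π → Swappable (perm π) j → perm (f j π) ≈ₚ perm π ·σ j)
  (f-fix  : ∀ j π → ¬ Swappable (perm π) j → perm (f j π) ≈ₚ perm π)
  where

  -- Involution and commutation relations

  f-swaps : (j : Fin (ℕ.suc m)) (π : ArcPermutation (2 + m)) (τ : Permutation′ (2 + m)) →
            perm π ≈ₚ τ → Swappable τ j → perm (f j π) ≈ₚ τ ·σ j
  f-swaps j π τ eq sw t = trans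
    (f-swap j π (Swappable-resp-≈ j τ (perm π) (sym ∘ eq) sw) t)
    (·σ-cong (perm π) τ j eq t)

  f-fixes : (j : Fin (ℕ.suc m)) (π : ArcPermutation (2 + m)) (τ : Permutation′ (2 + m)) →
            perm π ≈ₚ τ → ¬ Swappable τ j → perm (f j π) ≈ₚ τ
  f-fixes j π τ eq ¬sw t = trans
    (f-fix j π (¬sw ∘ Swappable-resp-≈ j (perm π) τ eq) t) (eq t)

  f-cong : (j : Fin (ℕ.suc m)) (π τ : ArcPermutation (2 + m)) →
           perm π ≈ₚ perm τ → perm (f j π) ≈ₚ perm (f j τ)
  f-cong j π τ eq = go (swappable? (perm τ) j)
    where
    go : Dec (Swappable (perm τ) j) → perm (f j π) ≈ₚ perm (f j τ)
    go (yes sw) t = trans (f-swaps j π (perm τ) eq sw t) (sym (f-swap j τ sw t))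
    go (no ¬sw) t = trans (f-fixes j π (perm τ) eq ¬sw t) (sym (f-fix j τ ¬sw t))

  f-involutive : (j : Fin (ℕ.suc m)) (π : ArcPermutation (2 + m)) → perm (f j (f j π)) ≈ₚ perm π
  f-involutive j π = go (swappable? (perm π) j)
    where
    σ : Permutation′ _
    σ = perm π

    σσ≈σ : (σ ·σ j) ·σ j ≈ₚ σ
    σσ≈σ = ·σ-involutive σ j

    go : Dec (Swappable σ j) → perm (f j (f j π)) ≈ₚ σ
    go (no ¬sw) = f-fixes j (f j π) σ (f-fix j π ¬sw) ¬sw
    go (yes sw) t = trans (f-swaps j (f j π) (σ ·σ j) (f-swap j π sw) again t) (σσ≈σ t)
      where
      -- The exchange back is allowed because it restores `π`, an arc permutation.
      again : Swappable (σ ·σ j) j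
      again = IsArc-·σ⇒Swappable (σ ·σ j) j
        (IsArc-resp-≈ σ ((σ ·σ j) ·σ j) (sym ∘ σσ≈σ) (isArc π))

  f-comm : {i j : Fin (ℕ.suc m)} → Far i j → (π : ArcPermutation (2 + m)) →
           perm (f i (f j π)) ≈ₚ perm (f j (f i π))
  f-comm {i = i} {j} far π = go (swappable? σ i) (swappable? σ j)
    where
    σ : Permutation′ _
    σ = perm π

    go : Dec (Swappable σ i) → Dec (Swappable σ j) →
         perm (f i (f j π)) ≈ₚ perm (f j (f i π))
    go (yes sᵢ) (yes sⱼ) t = trans
      (f-swaps i (f j π) (σ ·σ j) (f-swap j π sⱼ) (Swappable-far σ far sᵢ) t)
      (trans (·σ-comm σ (Far-sym far) t)
        (sym (f-swaps j (f i π) (σ ·σ i) (f-swap i π sᵢ)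
               (Swappable-far σ (Far-sym far) sⱼ) t)))
    go (yes sᵢ) (no ¬sⱼ) t = trans
      (f-swaps i (f j π) σ (f-fix j π ¬sⱼ) sᵢ t)
      (sym (f-fixes j (f i π) (σ ·σ i) (f-swap i π sᵢ)
             (¬sⱼ ∘ Swappable-far⁻ σ (Far-sym far)) t))
    go (no ¬sᵢ) (yes sⱼ) t = trans
      (f-fixes i (f j π) (σ ·σ j) (f-swap j π sⱼ) (¬sᵢ ∘ Swappable-far⁻ σ far) t)
      (sym (f-swaps j (f i π) σ (f-fix i π ¬sᵢ) sⱼ t))
    go (no ¬sᵢ) (no ¬sⱼ) t = trans
      (f-fixes i (f j π) σ (f-fix j π ¬sⱼ) ¬sᵢ t)
      (sym (f-fixes j (f i π) σ (f-fix i π ¬sᵢ) ¬sⱼ t))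

  -- Braid relations

  module Local (i : Fin m) (π : ArcPermutation (2 + m)) where
    open Triple i

    Pre Suf : Pred (Fin (2 + m)) 0ℓ
    Pre = Prefix (perm π) (toℕ i)
    Suf = Suffix (perm π) (2 + toℕ i)

    letter : Fin 3 → Fin (2 + m)
    letter 0F = perm π ⟨$⟩ʳ A
    letter 1F = perm π ⟨$⟩ʳ B
    letter 2F = perm π ⟨$⟩ʳ C

    -- The invariant along an orbit: with the outside letters unchanged, `Pre` and `Suf` stay the
    -- relevant sets, so the bits computed for `π` remain valid.
    record At (o : Order) (σ : Permutation′ (2 + m)) : Set where
      constructor mkAt
      field
        agree : ∀ t → Outside t → σ ⟨$⟩ʳ t ≡ perm π ⟨$⟩ʳ t
        at-A  : σ ⟨$⟩ʳ A ≡ letter (proj₁ o)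
        at-B  : σ ⟨$⟩ʳ B ≡ letter (proj₁ (proj₂ o))
        at-C  : σ ⟨$⟩ʳ C ≡ letter (proj₂ (proj₂ o))

    At-start : At (0F , 1F , 2F) (perm π)
    At-start = mkAt (λ _ _ → refl) refl refl refl

    At-return : ∀ σ → At (0F , 1F , 2F) σ → σ ≈ₚ perm π
    At-return σ (mkAt agree at-A at-B at-C) t with position t
    ... | atA       = at-A
    ... | atB       = at-B
    ... | atC       = at-C
    ... | outside o = agree t o

    module _ {o : Order} (σ : Permutation′ (2 + m)) (at : At o σ) where
      open At at
      private
        x₀ = proj₁ o
        y₀ = proj₁ (proj₂ o)
        z₀ = proj₂ (proj₂ o)

      At-resp-≈ : ∀ τ → τ ≈ₚ σ → At o τ
      At-resp-≈ τ eq = mkAt (λ t out → trans (eq t) (agree t out))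
        (trans (eq A) at-A) (trans (eq B) at-B) (trans (eq C) at-C)

      At-lo : At (y₀ , x₀ , z₀) (σ ·σ inject₁ i)
      At-lo = mkAt
        (λ t out → trans (·σ-other σ (inject₁ i) (λ { refl → A-inside out }) (λ { refl → B-inside out }))
                         (agree t out))
        (trans (·σ-inject₁ σ (inject₁ i)) at-B)
        (trans (·σ-suc σ (inject₁ i)) at-A)
        (trans (·σ-other σ (inject₁ i) (≢-sym A≢C) (≢-sym B≢C)) at-C)

      At-hi : At (x₀ , z₀ , y₀) (σ ·σ suc i)
      At-hi = mkAt
        (λ t out → trans (·σ-other σ (suc i) (λ { refl → B-inside out }) (λ { refl → C-inside out }))
                         (agree t out))
        (trans (·σ-other σ (suc i) A≢B A≢C) at-A)
        (trans (·σ-inject₁ σ (suc i)) at-C)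
        (trans (·σ-suc σ (suc i)) at-B)

      private
        same-prefix : Prefix σ (toℕ i) ∪ ｛ σ ⟨$⟩ʳ B ｝ ≐ Pre ∪ ｛ letter y₀ ｝
        same-prefix = subst (λ b → Prefix σ (toℕ i) ∪ ｛ σ ⟨$⟩ʳ B ｝ ≐ Pre ∪ ｛ b ｝) at-B
          (Sum.map₁ (proj₁ same) , Sum.map₁ (proj₂ same))
          where
          same : Prefix σ (toℕ i) ≐ Pre
          same = Prefix-cong σ (perm π) λ t t<i → agree t (inj₁ t<i)

        same-suffix : Suffix σ (2 + toℕ i) ∪ ｛ σ ⟨$⟩ʳ B ｝ ≐ Suf ∪ ｛ letter y₀ ｝
        same-suffix = subst (λ b → Suffix σ (2 + toℕ i) ∪ ｛ σ ⟨$⟩ʳ B ｝ ≐ Suf ∪ ｛ b ｝) at-B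
          ( Sum.map₁ (λ (t , lt , eq) → t , lt , trans (sym (agree t (inj₂ lt))) eq)
          , Sum.map₁ (λ (t , lt , eq) → t , lt , trans (agree t (inj₂ lt)) eq))

      swappable-lo : Cyclic (Pre ∪ ｛ letter y₀ ｝) → Swappable σ (inject₁ i)
      swappable-lo = subst id (sym (Swappable-lo σ)) ∘ Cyclic-resp-≐ (≐-sym same-prefix)

      swappable-lo⁻ : Swappable σ (inject₁ i) → Cyclic (Pre ∪ ｛ letter y₀ ｝)
      swappable-lo⁻ = Cyclic-resp-≐ same-prefix ∘ subst id (Swappable-lo σ)

      swappable-hi : Cyclic (Suf ∪ ｛ letter y₀ ｝) → Swappable σ (suc i)
      swappable-hi = Swappable-hi σ ∘ Cyclic-resp-≐ (≐-sym same-suffix)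

      swappable-hi⁻ : Swappable σ (suc i) → Cyclic (Suf ∪ ｛ letter y₀ ｝)
      swappable-hi⁻ = Cyclic-resp-≐ same-suffix ∘ Swappable-hi⁻ σ

    module _ {p q : Fin 3 → Bool}
      (p-reflects : ∀ t → Reflects (Cyclic (Pre ∪ ｛ letter t ｝)) (p t))
      (q-reflects : ∀ t → Reflects (Cyclic (Suf ∪ ｛ letter t ｝)) (q t)) where

      f-lo : ∀ {o} τ → At o (perm τ) → At (lo p o) (perm (f (inject₁ i) τ))
      f-lo {o} τ at = go (p-reflects (proj₁ (proj₂ o)))
        where
        σ = perm τ
        go : ∀ {b} → Reflects (Cyclic (Pre ∪ ｛ letter (proj₁ (proj₂ o)) ｝)) b →
             At (if b then (proj₁ (proj₂ o) , proj₁ o , proj₂ (proj₂ o)) else o)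
                (perm (f (inject₁ i) τ))
        go (ofʸ c)  = At-resp-≈ (σ ·σ inject₁ i) (At-lo σ at) _
          (f-swap (inject₁ i) τ (swappable-lo σ at c))
        go (ofⁿ ¬c) = At-resp-≈ σ at _
          (f-fix (inject₁ i) τ (¬c ∘ swappable-lo⁻ σ at))

      f-hi : ∀ {o} τ → At o (perm τ) → At (hi q o) (perm (f (suc i) τ))
      f-hi {o} τ at = go (q-reflects (proj₁ (proj₂ o)))
        where
        σ = perm τ
        go : ∀ {b} → Reflects (Cyclic (Suf ∪ ｛ letter (proj₁ (proj₂ o)) ｝)) b →
             At (if b then (proj₁ o , proj₂ (proj₂ o) , proj₁ (proj₂ o)) else o)
                (perm (f (suc i) τ))
        go (ofʸ c)  = At-resp-≈ (σ ·σ suc i) (At-hi σ at) _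
          (f-swap (suc i) τ (swappable-hi σ at c))
        go (ofⁿ ¬c) = At-resp-≈ σ at _
          (f-fix (suc i) τ (¬c ∘ swappable-hi⁻ σ at))

    CP : Cyclic Pre
    CP = IsArc⇒Cyclic-Prefix (perm π) (isArc π) (toℕ i)

    CR : Cyclic Suf
    CR = Cyclic-resp-≐ (≐-sym (Suffix≐∁Prefix (perm π) (2 + toℕ i)))
      (Cyclic-∁ (Prefix? (perm π) _) (IsArc⇒Cyclic-Prefix (perm π) (isArc π) _))

    -- This bit and `q₂` are forced: they concern the prefixes of `π` itself that end at `A` and at
    -- `B`, the latter through its complement.
    p₀ : Cyclic (Pre ∪ ｛ letter 0F ｝)
    p₀ = Cyclic-resp-≐ (Prefix-B (perm π)) (IsArc⇒Cyclic-Prefix (perm π) (isArc π) _)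

    q₂ : Cyclic (Suf ∪ ｛ letter 2F ｝)
    q₂ = to-suffix (split (perm π))
      (Cyclic-resp-≐ (Prefix-C (perm π)) (IsArc⇒Cyclic-Prefix (perm π) (isArc π) _))

    iterate : ℕ → ArcPermutation (2 + m)
    iterate ℕ.zero    = π
    iterate (ℕ.suc k) = f (inject₁ i) (f (suc i) (iterate k))

    pick : Bool → Bool → Bool → Fin 3 → Bool
    pick b₀ b₁ b₂ 0F = b₀
    pick b₀ b₁ b₂ 1F = b₁
    pick b₀ b₁ b₂ 2F = b₂

    -- With the four open bits as `Reflects` indices, `orbit` runs on literal booleans and its
    -- closing up is checked by `refl`.
    return : ∀ k {b₁ b₂ c₀ c₁} →
      Reflects (Cyclic (Pre ∪ ｛ letter 1F ｝)) b₁ → Reflects (Cyclic (Pre ∪ ｛ letter 2F ｝)) b₂ →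
      Reflects (Cyclic (Suf ∪ ｛ letter 0F ｝)) c₀ → Reflects (Cyclic (Suf ∪ ｛ letter 1F ｝)) c₁ →
      orbit (pick true b₁ b₂) (pick c₀ c₁ true) k ≡ (0F , 1F , 2F) →
      perm (iterate k) ≈ₚ perm π
    return k {b₁} {b₂} {c₀} {c₁} r₁ r₂ s₀ s₁ eq =
      At-return (perm (iterate k)) (subst (λ o → At o (perm (iterate k))) eq (track k))
      where
      p q : Fin 3 → Bool
      p = pick true b₁ b₂
      q = pick c₀ c₁ true

      p-reflects : ∀ t → Reflects (Cyclic (Pre ∪ ｛ letter t ｝)) (p t)
      p-reflects 0F = ofʸ p₀
      p-reflects 1F = r₁
      p-reflects 2F = r₂

      q-reflects : ∀ t → Reflects (Cyclic (Suf ∪ ｛ letter t ｝)) (q t)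
      q-reflects 0F = s₀
      q-reflects 1F = s₁
      q-reflects 2F = ofʸ q₂

      track : ∀ k → At (orbit p q k) (perm (iterate k))
      track ℕ.zero    = At-start
      track (ℕ.suc k) =
        f-lo p-reflects q-reflects {hi q (orbit p q k)} (f (suc i) (iterate k))
          (f-hi p-reflects q-reflects {orbit p q k} (iterate k) (track k))

    S : Split Pre Suf (letter 0F) (letter 1F) (letter 2F)
    S = split (perm π)

    Pre∪? : ∀ t → Dec (Cyclic (Pre ∪ ｛ letter t ｝))
    Pre∪? t = cyclic? (Split.P? S ∪? (letter t ≟_)) (letter t , inj₂ refl)

    Suf∪? : ∀ t → Dec (Cyclic (Suf ∪ ｛ letter t ｝))
    Suf∪? t = cyclic? (Split.R? S ∪? (letter t ≟_)) (letter t , inj₂ refl)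

    -- By `not-all` at most one of `p₁`, `p₂` and at most one of `q₀`, `q₁` holds. Of the nine
    -- remaining patterns, `spread` and `two⇒third` refute five; in the other four `π` is an end,
    -- the middle or the other end of a path with three vertices, or is fixed by both maps.
    hexagon : Satisfiable Pre → Satisfiable Suf → perm (iterate 3) ≈ₚ perm π
    hexagon ∃Pre ∃Suf = go (Pre∪? 1F) (Pre∪? 2F) (Suf∪? 0F) (Suf∪? 1F)
      where
      go : Dec (Cyclic (Pre ∪ ｛ letter 1F ｝)) → Dec (Cyclic (Pre ∪ ｛ letter 2F ｝)) →
           Dec (Cyclic (Suf ∪ ｛ letter 0F ｝)) → Dec (Cyclic (Suf ∪ ｛ letter 1F ｝)) →
           perm (iterate 3) ≈ₚ perm π
      go (yes p₁) (yes p₂) _        _        = contradiction p₂ (not-all S CP ∃Pre p₀ p₁)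
      go _        _        (yes q₀) (yes q₁) = contradiction q₀ (not-all (flip S) CR ∃Suf q₂ q₁)
      go (yes p₁) (no ¬p₂) (yes q₀) (no ¬q₁) = return 3 (ofʸ p₁) (ofⁿ ¬p₂) (ofʸ q₀) (ofⁿ ¬q₁) refl
      go (yes p₁) (no ¬p₂) (no ¬q₀) (yes q₁) = return 3 (ofʸ p₁) (ofⁿ ¬p₂) (ofⁿ ¬q₀) (ofʸ q₁) refl
      go (no ¬p₁) (yes p₂) (no ¬q₀) (yes q₁) = return 3 (ofⁿ ¬p₁) (ofʸ p₂) (ofⁿ ¬q₀) (ofʸ q₁) refl
      go (no ¬p₁) (no ¬p₂) (no ¬q₀) (no ¬q₁) = return 3 (ofⁿ ¬p₁) (ofⁿ ¬p₂) (ofⁿ ¬q₀) (ofⁿ ¬q₁) refl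
      go (yes p₁) (no _)   (no ¬q₀) (no ¬q₁) =
        contradiction (spread (flip S) CR ∃Suf q₂ p₀ p₁) [ ¬q₁ , ¬q₀ ]′
      go (no _)   (yes p₂) _        (no ¬q₁) =
        contradiction (two⇒third (swapʳ S) CP ∃Pre p₀ p₂) ¬q₁
      go (no ¬p₁) _        (yes q₀) (no _)   =
        contradiction (two⇒third (swapʳ (flip S)) CR ∃Suf q₂ q₀) ¬p₁
      go (no ¬p₁) (no ¬p₂) (no _)   (yes q₁) =
        contradiction (spread S CP ∃Pre p₀ q₂ q₁) [ ¬p₁ , ¬p₂ ]′

    -- All `p` bits are true and exactly one of `q₀`, `q₁` is: `π` is an end of a path with four
    -- vertices if `q₀` holds, and an inner vertex if `q₁` does.
    octagon-start : (∀ w → w ∉ Pre) → Satisfiable Suf → perm (iterate 4) ≈ₚ perm π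
    octagon-start Pre=∅ ∃Suf = go (Suf∪? 0F) (Suf∪? 1F)
      where
      p : ∀ t → Reflects (Cyclic (Pre ∪ ｛ letter t ｝)) true
      p _ = ofʸ (Cyclic-singleton Pre=∅)

      go : Dec (Cyclic (Suf ∪ ｛ letter 0F ｝)) → Dec (Cyclic (Suf ∪ ｛ letter 1F ｝)) →
           perm (iterate 4) ≈ₚ perm π
      go (yes q₀) (yes q₁) = contradiction q₀ (not-all (flip S) CR ∃Suf q₂ q₁)
      go (yes q₀) (no ¬q₁) = return 4 (p 1F) (p 2F) (ofʸ q₀) (ofⁿ ¬q₁) refl
      go (no ¬q₀) (yes q₁) = return 4 (p 1F) (p 2F) (ofⁿ ¬q₀) (ofʸ q₁) refl
      go (no ¬q₀) (no ¬q₁) = contradiction (one-more (flip S) Pre=∅ CR ∃Suf q₂) [ ¬q₁ , ¬q₀ ]′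

    octagon-end : (∀ w → w ∉ Suf) → Satisfiable Pre → perm (iterate 4) ≈ₚ perm π
    octagon-end Suf=∅ ∃Pre = go (Pre∪? 1F) (Pre∪? 2F)
      where
      q : ∀ t → Reflects (Cyclic (Suf ∪ ｛ letter t ｝)) true
      q _ = ofʸ (Cyclic-singleton Suf=∅)

      go : Dec (Cyclic (Pre ∪ ｛ letter 1F ｝)) → Dec (Cyclic (Pre ∪ ｛ letter 2F ｝)) →
           perm (iterate 4) ≈ₚ perm π
      go (yes p₁) (yes p₂) = contradiction p₂ (not-all S CP ∃Pre p₀ p₁)
      go (yes p₁) (no ¬p₂) = return 4 (ofʸ p₁) (ofⁿ ¬p₂) (q 0F) (q 1F) refl
      go (no ¬p₁) (yes p₂) = return 4 (ofⁿ ¬p₁) (ofʸ p₂) (q 0F) (q 1F) refl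
      go (no ¬p₁) (no ¬p₂) = contradiction (one-more S Suf=∅ CP ∃Pre p₀) [ ¬p₁ , ¬p₂ ]′

    ∃Pre : 1 ℕ.≤ toℕ i → Satisfiable Pre
    ∃Pre 1≤i = perm π ⟨$⟩ʳ zero , zero , 1≤i , refl

    ∃Suf : 1 + toℕ i ℕ.< m → Satisfiable Suf
    ∃Suf 1+i<m = perm π ⟨$⟩ʳ fromℕ (1 + m) , fromℕ (1 + m)
      , subst (2 + toℕ i ℕ.<_) (sym (toℕ-fromℕ (1 + m))) (ℕ.s<s 1+i<m) , refl

    Pre=∅ : toℕ i ≡ 0 → ∀ w → w ∉ Pre
    Pre=∅ i≡0 w (t , t<i , _) = ℕ.n≮0 (subst (toℕ t ℕ.<_) i≡0 t<i)

    Suf=∅ : 1 + toℕ i ≡ m → ∀ w → w ∉ Suf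
    Suf=∅ 1+i≡m w (t , t> , _) =
      ℕ.<⇒≱ t> (ℕ.≤-trans (ℕ.≤-pred (toℕ<n t)) (ℕ.≤-reflexive (cong ℕ.suc (sym 1+i≡m))))

  action-∃! : 2 ≤ m → ∃! _≗ᵃ_ (λ (α : Action (C̃ m) (𝒜 (2 + m))) → Extends f α)
  action-∃! 2≤m = action relators , (λ _ _ _ → refl) , λ {β} → action-unique relators β
    where
    open Involutions (C̃-Relator m) (𝒜 (2 + m)) f
      (λ i {π} {τ} → f-cong i π τ) f-involutive

    relators : ∀ {w} → C̃-Relator m w → ∀ π → perm (act w π) ≈ₚ perm π
    relators (involution i)    π = f-involutive i π
    relators (commute i j gap) π t = trans
      (f-comm (∣-∣>1⇒Far i j gap) (f i (f j π)) t)
      (trans (f-cong j (f i (f i (f j π))) (f j π) (f-involutive i (f j π)) t)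
             (f-involutive j π t))
    relators (braid₃ i 1≤i 1+i<m)    π = hexagon (∃Pre 1≤i) (∃Suf 1+i<m)
      where open Local i π
    -- `2 ≤ m` leaves a letter on the other side of the triple. With both sides empty the six
    -- orderings would form a closed hexagon, on which the product has order 3 instead of 4.
    relators (braid₄ i (inj₁ i≡0))   π =
      octagon-start (Pre=∅ i≡0) (∃Suf (subst (λ l → 1 + l ℕ.< m) (sym i≡0) 2≤m))
      where open Local i π
    relators (braid₄ i (inj₂ 1+i≡m)) π =
      octagon-end (Suf=∅ 1+i≡m) (∃Pre (ℕ.≤-pred (subst (2 ≤_) (sym 1+i≡m) 2≤m)))
      where open Local i π

proposition10p2 : (m : ℕ) → 2 ≤ m →
    ∃! _≗ᵃ_ (λ (α : Action (C̃ m) (𝒜 (2 + m))) → Extends ρ α)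
proposition10p2 m = Moves.action-∃! ρ ρ-swap ρ-fix
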